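{- Let $\mathbb{F}$ be a field and let $P$ be a syntactic multilinear ABP of size $S$ computing a multilinear polynomial $f\in\mathbb{F}[x_1,\ldots,x_n]$. Then there is a syntactic multilinear formula $\Phi$ computing $f$, of size $S^{O(\log n)}$ and depth $O(\log n)$, such that every leaf $w$ of $\Phi$ represents a multilinear polynomial $[u,v]_{P_w}$ for some nodes $u,v$ in $P_w$ with $|X_{u,v}|\le\sqrt n$, where $P_w$ is a subprogram of $P$. Further, any parse tree of $\Phi$ has at most $3\sqrt n$ leaves.
   Context: Let $X=\{x_1,\ldots,x_n\}$. An algebraic branching program (ABP) $P$ over $\mathbb{F}$ is a directed acyclic graph whose vertices are partitioned into layers $L_0,\ldots,L_\ell$, with edges only from $L_i$ to $L_{i+1}$; $L_0=\{s\}$ (source, the one vertex of in-degree 0) and $L_\ell=\{t\}$ (sink, the one vertex of out-degree 0). Each edge is labeled by an element of $X\cup\mathbb{F}$. The size is the number of nodes. The polynomial computed is the sum over all $s$-to-$t$ paths of the product of the edge labels. $P$ is syntactic multilinear if every variable occurs at most once on every $s$-to-$t$ path. A subprogram of $P$ is a program formed by some of the nodes and edges of $P$ (with their labels), with a designated source and sink. For nodes $u,v$ of a program $P'$, $[u,v]_{P'}$ is the polynomial computed by the subprogram of $P'$ with source $u$ and sink $v$, i.e. the sum over all $u$-to-$v$ paths in $P'$ of the product of the edge labels, and $X_{u,v}$ is the set of all variables that occur as labels on some $u$-to-$v$ path in the program in question. An arithmetic circuit over $\mathbb{F}$ is a directed acyclic graph with vertices (gates) of in-degree at most 2; gates of in-degree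 0 (input gates, or leaves) are labeled by elements of $X\cup\mathbb{F}$, internal gates are labeled $+$ or $\times$, and a gate of out-degree 0 is an output gate. Every gate naturally computes a polynomial, and the circuit computes the polynomial at its output gate. The size is the number of gates and the depth is the length of the longest path from an input gate to the output gate. An arithmetic formula is an arithmetic circuit whose underlying undirected graph is a tree; in the statement above the leaves of the formula $\Phi$ represent multilinear polynomials as described there, instead of single variables or constants. A circuit or formula is syntactic multilinear if the children of every product gate depend on disjoint sets of variables. A parse tree of a formula is a subtree containing the output gate such that for every $+$ gate in it exactly one child is in it, and for every $\times$ gate in it both children are in it.
   Formalization: Sum gates of the formula have arbitrary positive fan-in (product gates have fan-in 2) instead of in-degree at most 2; with in-degree at most 2, depth O(log n) fails by a counting argument over F_2 for programs of size 2^{O(n)}. -}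

module Defs where

open import Algebra.Apartness.Bundles using (HeytingField)
open import Data.Bool.Base using (if_then_else_)
open import Data.Fin.Base using (Fin; zero; toℕ; fromℕ)
open import Data.Fin.Properties using () renaming (_≟_ to _≟F_)
open import Data.Fin.Subset using (Subset; _∈_; _∪_; _∩_; ⁅_⁆; ⋃; Empty)
open import Data.List.Base
  using (List; []; _∷_; [_]; _++_; map; foldr; concatMap; mapMaybe; upTo; allFin; tabulate; cartesianProductWith)
open import Data.List.Relation.Unary.All using (All)
open import Data.List.Relation.Unary.Unique.Propositional using (Unique)
open import Data.Maybe.Base using (Maybe; just; nothing; maybe′)
open import Data.Nat.Base using (ℕ; zero; suc; _+_; _⊔_; _≤_)
open import Data.Nat.ListAction using (sum)
open import Data.Nat.Properties using () renaming (_≟_ to _≟ℕ_)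
open import Data.Product.Base using (_×_; _,_)
open import Data.Unit.Polymorphic.Base using (⊤)
open import Data.Vec.Base using (Vec; lookup; replicate; zipWith; _[_]≔_)
open import Data.Vec.Properties using (≡-dec)
open import Function.Base using (_∘_)
open import Function.Bundles using (_⇔_)
open import Relation.Binary.PropositionalEquality.Core using (_≡_)
open import Relation.Nullary.Decidable.Core using (⌊_⌋)

module Multilinear {a ℓ₁ ℓ₂} (𝔽 : HeytingField a ℓ₁ ℓ₂) (n : ℕ) where

  private module 𝔽 = HeytingField 𝔽

  -- 𝔽[x₁,…,xₙ] as formal finite sums of terms.  Terms may be repeated or
  -- have coefficient zero, so equality is equality of all coefficients.

  Monomial : Set
  Monomial = Vec ℕ n

  Poly : Set a
  Poly = List (𝔽.Carrier × Monomial)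

  coeff : Poly → Monomial → 𝔽.Carrier
  coeff []            α = 𝔽.0#
  coeff ((c , β) ∷ p) α = (if ⌊ ≡-dec _≟ℕ_ β α ⌋ then c else 𝔽.0#) 𝔽.+ coeff p α

  infix 4 _≈ₚ_
  _≈ₚ_ : Poly → Poly → Set ℓ₁
  p ≈ₚ q = ∀ α → coeff p α 𝔽.≈ coeff q α

  constₚ : 𝔽.Carrier → Poly
  constₚ c = [ c , replicate n 0 ]

  varₚ : Fin n → Poly
  varₚ i = [ 𝔽.1# , replicate n 0 [ i ]≔ 1 ]

  infixl 6 _+ₚ_
  infixl 7 _*ₚ_

  _+ₚ_ : Poly → Poly → Poly
  _+ₚ_ = _++_

  _*ₚ_ : Poly → Poly → Poly
  _*ₚ_ = cartesianProductWith λ where (c , α) (d , β) → c 𝔽.* d , zipWith _+_ α β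

  ∑ ∏ : List Poly → Poly
  ∑ = foldr _+ₚ_ []
  ∏ = foldr _*ₚ_ (constₚ 𝔽.1#)

  IsMultilinear : Poly → Set ℓ₁
  IsMultilinear p = ∀ α i → 2 ≤ lookup α i → coeff p α 𝔽.≈ 𝔽.0#

  data Label : Set a where
    var   : Fin n → Label
    const : 𝔽.Carrier → Label

  labelPoly : Label → Poly
  labelPoly (var i)   = varₚ i
  labelPoly (const c) = constₚ c

  variable? : Label → Maybe (Fin n)
  variable? (var i)   = just i
  variable? (const _) = nothing

  variables : List Label → List (Fin n)
  variables = mapMaybe variable?

  Edges : ℕ → Set a
  Edges S = Fin S → Fin S → Maybe Label

  -- ℓ bounds the length of every path; in a layered graph it is the index
  -- of the last layer.
  module Paths {S : ℕ} (ℓ : ℕ) (E : Edges S) where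

    -- A path is recorded by its sequence of edge labels.  The lists have one
    -- entry per path, so distinct paths with equal labels are all counted.
    pathsOfLength : ℕ → Fin S → Fin S → List (List Label)
    pathsOfLength zero    u v = if ⌊ u ≟F v ⌋ then [ [] ] else []
    pathsOfLength (suc k) u v =
      concatMap (λ w → maybe′ (λ x → map (x ∷_) (pathsOfLength k w v)) [] (E u w)) (allFin S)

    paths : Fin S → Fin S → List (List Label)
    paths u v = concatMap (λ k → pathsOfLength k u v) (upTo (suc ℓ))

    pathPoly : Fin S → Fin S → Poly
    pathPoly u v = ∑ (map (∏ ∘ map labelPoly) (paths u v))

    pathVars : Fin S → Fin S → Subset n
    pathVars u v = ⋃ (map (⋃ ∘ map ⁅_⁆ ∘ variables) (paths u v))

  record ABP : Set a where
    field
      size   : ℕ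
      ℓ      : ℕ
      layer  : Fin size → Fin (suc ℓ)
      edge   : Edges size
      source : Fin size
      sink   : Fin size
      layered     : ∀ {u v x} → edge u v ≡ just x → toℕ (layer v) ≡ suc (toℕ (layer u))
      firstLayer  : ∀ v → layer v ≡ zero ⇔ v ≡ source
      lastLayer   : ∀ v → layer v ≡ fromℕ ℓ ⇔ v ≡ sink
      inDegree-0  : ∀ v → (∀ u → edge u v ≡ nothing) ⇔ v ≡ source
      outDegree-0 : ∀ u → (∀ v → edge u v ≡ nothing) ⇔ u ≡ sink

    open Paths ℓ edge public

    poly : Poly
    poly = pathPoly source sink

    IsSyntacticMultilinear : Set a
    IsSyntacticMultilinear = All (Unique ∘ variables) (paths source sink)

  record Subprogram (P : ABP) : Set a where
    private module P = ABP P
    field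
      nodes  : Subset P.size
      edge   : Edges P.size
      source : Fin P.size
      sink   : Fin P.size
      source∈nodes : source ∈ nodes
      sink∈nodes   : sink ∈ nodes
      edge⊆        : ∀ {u v x} → edge u v ≡ just x → P.edge u v ≡ just x × u ∈ nodes × v ∈ nodes

    open Paths P.ℓ edge public

  module _ (P : ABP) where

    record Leaf : Set a where
      field
        program : Subprogram P
      open Subprogram program using (nodes; pathPoly; pathVars)
      field
        u v     : Fin (ABP.size P)
        u∈nodes : u ∈ nodes
        v∈nodes : v ∈ nodes

      poly : Poly
      poly = pathPoly u v

      vars : Subset n
      vars = pathVars u v

    -- Sum gates have arbitrary positive fan-in.  With fan-in two, depth
    -- O(log n) would leave only n^O(1) leaves on at most √n variables each,
    -- too few to express every polynomial of a program of size 2^O(n).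
    data Formula : Set a where
      leaf : Leaf → Formula
      plus : ∀ {k} → (Fin (suc k) → Formula) → Formula
      _⊗_  : Formula → Formula → Formula

  module _ {P : ABP} where

    formulaPoly : Formula P → Poly
    formulaPoly (leaf w) = Leaf.poly w
    formulaPoly (plus φ) = ∑ (tabulate λ i → formulaPoly (φ i))
    formulaPoly (φ ⊗ ψ)  = formulaPoly φ *ₚ formulaPoly ψ

    formulaVars : Formula P → Subset n
    formulaVars (leaf w) = Leaf.vars w
    formulaVars (plus φ) = ⋃ (tabulate λ i → formulaVars (φ i))
    formulaVars (φ ⊗ ψ)  = formulaVars φ ∪ formulaVars ψ

    formulaSize : Formula P → ℕ
    formulaSize (leaf _) = 1
    formulaSize (plus φ) = suc (sum (tabulate λ i → formulaSize (φ i)))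
    formulaSize (φ ⊗ ψ)  = suc (formulaSize φ + formulaSize ψ)

    depth : Formula P → ℕ
    depth (leaf _) = 0
    depth (plus φ) = suc (foldr _⊔_ 0 (tabulate λ i → depth (φ i)))
    depth (φ ⊗ ψ)  = suc (depth φ ⊔ depth ψ)

    IsSyntacticMultilinearFormula : Formula P → Set
    IsSyntacticMultilinearFormula (leaf _) = ⊤
    IsSyntacticMultilinearFormula (plus φ) = ∀ i → IsSyntacticMultilinearFormula (φ i)
    IsSyntacticMultilinearFormula (φ ⊗ ψ)  =
      Empty (formulaVars φ ∩ formulaVars ψ) ×
      IsSyntacticMultilinearFormula φ × IsSyntacticMultilinearFormula ψ

    AllLeaves : ∀ {p} → (Leaf P → Set p) → Formula P → Set p
    AllLeaves Q (leaf w) = Q w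
    AllLeaves Q (plus φ) = ∀ i → AllLeaves Q (φ i)
    AllLeaves Q (φ ⊗ ψ)  = AllLeaves Q φ × AllLeaves Q ψ

    data ParseTree : Formula P → Set a where
      leaf : ∀ {w} → ParseTree (leaf w)
      plus : ∀ {k} {φ : Fin (suc k) → Formula P} (i : Fin (suc k)) → ParseTree (φ i) → ParseTree (plus φ)
      _⊗_  : ∀ {φ ψ} → ParseTree φ → ParseTree ψ → ParseTree (φ ⊗ ψ)

    leafCount : ∀ {Φ} → ParseTree Φ → ℕ
    leafCount leaf       = 1
    leafCount (plus _ τ) = leafCount τ
    leafCount (τ ⊗ σ)    = leafCount τ + leafCount σ

{-# OPTIONS --safe #-}
module Submission where

-- Cut the walks from u to v at the first edge (c , d) at which the number of variables seen from u exceeds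
-- half of |X_{u,v}|.  Each walk has exactly one such edge, so [u,v] is the sum over these edges of [u,c] times
-- [c,v], where the second factor is computed in the subprogram whose only edge leaving c goes to d.  By syntactic
-- multilinearity the two factors have disjoint variable sets, of sizes at most ⌊m/2⌋ and ⌈m/2⌉ for m = |X_{u,v}|.
-- With r = ⌊√n⌋ and r + 2 ≤ 2ᵈ ≤ 2(r + 1), the bound m ≤ r 2ᵈ therefore drops to m ≤ r after at most d rounds,
-- and a parse tree has at most 2ᵈ ≤ 3√n leaves.

open import Algebra.Apartness.Bundles using (HeytingField; HeytingCommutativeRing)
open import Algebra.Bundles using (CommutativeRing; Semiring)
import Algebra.Properties.CommutativeSemigroup as CommutativeSemigroupProperties
open import Data.Bool.Base using (if_then_else_)
open import Data.Fin.Base using (Fin; zero; suc; toℕ)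
open import Data.Fin.Properties using (toℕ<n) renaming (_≟_ to _≟F_)
open import Data.Fin.Subset
  using ( Subset; _⊆_; _∪_; _∩_; Empty; ⁅_⁆; ⋃; ∣_∣; inside; outside
        )
  renaming (_∈_ to _∈ₛ_; ⊥ to ∅; ⊤ to full)
open import Data.Fin.Subset.Properties
  using ( x∈p∩q⁺; x∈p∩q⁻; x∈p∪q⁺; x∈p∪q⁻; x∈⁅x⁆; x∈⁅y⁆⇒x≡y; ∈⊤; ∉⊥; drop-∷-Empty; p⊆q⇒∣p∣≤∣q∣; ∣p∣≤n; ∣⊥∣≡0
        ; ∣⁅x⁆∣≡1
        )
open import Data.List.Base
  using ( List; []; _∷_; [_]; _++_; map; foldr; length; lookup; filter; concatMap; tabulate; allFin; upTo
        ; applyUpTo; cartesianProduct; cartesianProductWith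
        )
open import Data.List.Membership.Propositional using (_∈_; find; lose)
open import Data.List.Membership.Propositional.Properties
  using ( ∈-++⁺ˡ; ∈-++⁺ʳ; ∈-++⁻; ∈-map⁺; ∈-map⁻; ∈-concatMap⁺; ∈-concatMap⁻; ∈-filter⁺; ∈-filter⁻
        ; ∈-cartesianProduct⁺; ∈-cartesianProductWith⁻; ∈-allFin; ∈-upTo⁺; ∈-lookup
        )
open import Data.List.Properties
  using ( ++-assoc; ++-identityʳ; map-∘; map-tabulate; map-upTo; upTo-∷ʳ; concatMap-cong; mapMaybe-++
        ; length-++; length-map; length-tabulate; length-filter
        )
open import Data.List.Relation.Unary.All as All using ([]; _∷_)
open import Data.List.Relation.Unary.All.Properties using (++⁻ˡ)
open import Data.List.Relation.Unary.AllPairs using ([]; _∷_)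
open import Data.List.Relation.Unary.Any as Any using (Any; here; there)
open import Data.List.Relation.Unary.Any.Properties using () renaming (map⁺ to Any-map⁺; map⁻ to Any-map⁻)
open import Data.List.Relation.Unary.Unique.Propositional using (Unique)
open import Data.Maybe.Base using (Maybe; just; nothing; maybe′)
open import Data.Maybe.Properties using (just-injective)
open import Data.Nat.Base using (ℕ; zero; suc; _<_)
open import Data.Nat.Induction using (<-wellFounded)
open import Data.Nat.ListAction using (sum)
open import Data.Nat.Logarithm using (⌊log₂_⌋; ⌊log₂⌋-mono-≤; ⌊log₂[2^n]⌋≡n)
open import Data.Nat.Tactic.RingSolver using (solve-∀)
open import Data.Product.Base using (∃; ∃₂; _×_; _,_; proj₁; proj₂)
open import Data.Sum.Base using (_⊎_; inj₁; inj₂)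
open import Data.Unit.Polymorphic.Base using (tt)
open import Data.Vec.Base as Vec using (replicate; zipWith)
open import Data.Vec.Properties
  using ( ≡-dec; zipWith-assoc; zipWith-identityˡ; zipWith-identityʳ; lookup-zipWith; lookup-replicate
        ; lookup∘update; lookup∘update′
        )
open import Function.Base using (_∘_; id)
open import Induction.WellFounded using (Acc; acc)
open import Level using () renaming (_⊔_ to _⊔ˡ_)
import Relation.Binary.Reasoning.Setoid as SetoidReasoning
open import Relation.Binary.PropositionalEquality.Core using (_≡_; _≢_; refl; sym; trans; cong; cong₂; subst)
open import Relation.Nullary using (¬_; Dec; yes; no; contradiction)
open import Relation.Nullary.Decidable using (⌊_⌋; _×-dec_; ¬?)
open import Relation.Unary using (Pred; Decidable)
open import Defs

-- Sums over lists and the walks of a ranked graph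

module ListSum {c ℓ} (R : Semiring c ℓ) where

  open Semiring R hiding (zero) renaming (refl to ≈-refl; sym to ≈-sym; trans to ≈-trans; reflexive to ≈-reflexive)
  open CommutativeSemigroupProperties +-commutativeSemigroup using (interchange)
  open SetoidReasoning setoid

  sumOver : ∀ {i} {I : Set i} → List I → (I → Carrier) → Carrier
  sumOver xs f = foldr _+_ 0# (map f xs)

  module _ {i} {I : Set i} where

    sum-cong : ∀ {f g : I → Carrier} xs → (∀ x → f x ≈ g x) → sumOver xs f ≈ sumOver xs g
    sum-cong []       f≈g = ≈-refl
    sum-cong (x ∷ xs) f≈g = +-cong (f≈g x) (sum-cong xs f≈g)

    sum-zero : ∀ {f : I → Carrier} xs → (∀ x → f x ≈ 0#) → sumOver xs f ≈ 0#
    sum-zero []       f≈0 = ≈-refl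
    sum-zero (x ∷ xs) f≈0 = ≈-trans (+-cong (f≈0 x) (sum-zero xs f≈0)) (+-identityˡ 0#)

    sum-+ : ∀ (f g : I → Carrier) xs → sumOver xs (λ x → f x + g x) ≈ sumOver xs f + sumOver xs g
    sum-+ f g []       = ≈-sym (+-identityˡ 0#)
    sum-+ f g (x ∷ xs) = ≈-trans (+-congˡ (sum-+ f g xs)) (interchange _ _ _ _)

    sum-distribˡ : ∀ y (f : I → Carrier) xs → y * sumOver xs f ≈ sumOver xs (λ x → y * f x)
    sum-distribˡ y f []       = zeroʳ y
    sum-distribˡ y f (x ∷ xs) = ≈-trans (distribˡ _ _ _) (+-congˡ (sum-distribˡ y f xs))

    sum-distribʳ : ∀ y (f : I → Carrier) xs → sumOver xs f * y ≈ sumOver xs (λ x → f x * y)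
    sum-distribʳ y f []       = zeroˡ y
    sum-distribʳ y f (x ∷ xs) = ≈-trans (distribʳ _ _ _) (+-congˡ (sum-distribʳ y f xs))

    sum-filter : ∀ {p} {Q : Pred I p} (Q? : Decidable Q) (f : I → Carrier) xs →
                 sumOver (filter Q? xs) f ≈ sumOver xs (λ x → if ⌊ Q? x ⌋ then f x else 0#)
    sum-filter Q? f []       = ≈-refl
    sum-filter Q? f (x ∷ xs) with Q? x
    ... | yes _ = +-congˡ (sum-filter Q? f xs)
    ... | no  _ = ≈-trans (sum-filter Q? f xs) (≈-sym (+-identityˡ _))

  sum-swap : ∀ {i j} {I : Set i} {J : Set j} (f : I → J → Carrier) xs ys →
             sumOver xs (λ x → sumOver ys (f x)) ≈ sumOver ys (λ y → sumOver xs (λ x → f x y))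
  sum-swap f []       ys = ≈-sym (sum-zero ys (λ _ → ≈-refl))
  sum-swap f (x ∷ xs) ys = ≈-trans (+-congˡ (sum-swap f xs ys)) (≈-sym (sum-+ _ _ ys))

  sum-++ : ∀ {i} {I : Set i} (f : I → Carrier) xs ys → sumOver (xs ++ ys) f ≈ sumOver xs f + sumOver ys f
  sum-++ f []       ys = ≈-sym (+-identityˡ _)
  sum-++ f (x ∷ xs) ys = ≈-trans (+-congˡ (sum-++ f xs ys)) (≈-sym (+-assoc _ _ _))

  sum-map : ∀ {i j} {I : Set i} {J : Set j} (h : J → I) (f : I → Carrier) xs → sumOver (map h xs) f ≡ sumOver xs (f ∘ h)
  sum-map h f xs = cong (foldr _+_ 0#) (sym (map-∘ xs))

  sum-tabulate : ∀ {S i} {I : Set i} (h : Fin S → I) (f : I → Carrier) →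
                 sumOver (tabulate h) f ≡ sumOver (allFin S) (f ∘ h)
  sum-tabulate h f = cong (foldr _+_ 0#) (trans (map-tabulate h f) (sym (map-tabulate _ (f ∘ h))))

  sum-cartesianProductWith : ∀ {i j k} {I : Set i} {J : Set j} {K : Set k} (g : I → J → K) (f : K → Carrier) xs ys →
    sumOver (cartesianProductWith g xs ys) f ≈ sumOver xs (λ x → sumOver ys (λ y → f (g x y)))
  sum-cartesianProductWith g f []       ys = ≈-refl
  sum-cartesianProductWith g f (x ∷ xs) ys =
    ≈-trans (sum-++ f (map (g x) ys) _)
            (+-cong (≈-reflexive (sum-map (g x) f ys)) (sum-cartesianProductWith g f xs ys))

  sum-concatMap : ∀ {i j} {I : Set i} {J : Set j} (g : I → List J) (f : J → Carrier) xs →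
                  sumOver (concatMap g xs) f ≈ sumOver xs (λ x → sumOver (g x) f)
  sum-concatMap g f []       = ≈-refl
  sum-concatMap g f (x ∷ xs) = ≈-trans (sum-++ f (g x) _) (+-congˡ (sum-concatMap g f xs))

  δ : ∀ {S} → Fin S → Fin S → Carrier
  δ u v = if ⌊ u ≟F v ⌋ then 1# else 0#

  δ-suc : ∀ {S} (u v : Fin S) → δ (suc u) (suc v) ≈ δ u v
  δ-suc u v with u ≟F v
  ... | yes _ = ≈-refl
  ... | no  _ = ≈-refl

  sum-δ : ∀ {S} (u : Fin S) (f : Fin S → Carrier) → sumOver (allFin S) (λ a → δ u a * f a) ≈ f u
  sum-δ {suc S} zero f = begin
    1# * f zero + sumOver (tabulate suc) (λ a → δ zero a * f a)
      ≈⟨ +-cong (*-identityˡ _) (≈-reflexive (sum-tabulate {S} suc _)) ⟩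
    f zero + sumOver (allFin S) (λ a → δ zero (suc a) * f (suc a))
      ≈⟨ +-congˡ (sum-zero (allFin S) (λ a → zeroˡ _)) ⟩
    f zero + 0#  ≈⟨ +-identityʳ _ ⟩
    f zero       ∎
  sum-δ {suc S} (suc u) f = begin
    0# * f zero + sumOver (tabulate suc) (λ a → δ (suc u) a * f a)
      ≈⟨ +-cong (zeroˡ _) (≈-reflexive (sum-tabulate {S} suc _)) ⟩
    0# + sumOver (allFin S) (λ a → δ (suc u) (suc a) * f (suc a))
      ≈⟨ +-identityˡ _ ⟩
    sumOver (allFin S) (λ a → δ (suc u) (suc a) * f (suc a))
      ≈⟨ sum-cong (allFin S) (λ a → *-congʳ (δ-suc u a)) ⟩
    sumOver (allFin S) (λ a → δ u a * f (suc a))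
      ≈⟨ sum-δ u (f ∘ suc) ⟩
    f (suc u) ∎

  module Cut {S t} (A G : Fin S → Fin S → Carrier) (rank : Fin S → ℕ)
             (A-ranked  : ∀ u w → A u w ≈ 0# ⊎ rank w < rank u)
             (G-unfold  : ∀ u v → G u v ≈ δ u v + sumOver (allFin S) (λ w → A u w * G w v))
             {T : Pred (Fin S) t} (T? : Decidable T)
             (no-return : ∀ {w a} → ¬ T w → T a → G w a ≈ 0#)
             where

    crossing : Fin S → Fin S → Carrier
    crossing v b = if ⌊ T? b ⌋ then 0# else G b v

    exit : Fin S → Fin S → Carrier
    exit v a = if ⌊ T? a ⌋ then sumOver (allFin S) (λ b → A a b * crossing v b) else 0#

    cutSum : Fin S → Fin S → Carrier
    cutSum v u = sumOver (allFin S) (λ a → G u a * exit v a)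

    cutSum-outside : ∀ v {u} → ¬ T u → cutSum v u ≈ 0#
    cutSum-outside v {u} u∉T = sum-zero (allFin S) vanish
      where
      vanish : ∀ a → G u a * exit v a ≈ 0#
      vanish a with T? a
      ... | yes a∈T = ≈-trans (*-congʳ (no-return u∉T a∈T)) (zeroˡ _)
      ... | no  _   = zeroʳ _

    cutSum-unfold : ∀ v u → cutSum v u ≈ exit v u + sumOver (allFin S) (λ w → A u w * cutSum v w)
    cutSum-unfold v u = begin
      cutSum v u
        ≈⟨ sum-cong V (λ a → ≈-trans (*-congʳ (G-unfold u a)) (distribʳ _ _ _)) ⟩
      sumOver V (λ a → δ u a * exit v a + sumOver V (λ w → A u w * G w a) * exit v a)
        ≈⟨ sum-+ _ _ V ⟩
      sumOver V (λ a → δ u a * exit v a) + sumOver V (λ a → sumOver V (λ w → A u w * G w a) * exit v a)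
        ≈⟨ +-cong (sum-δ u (exit v)) (sum-cong V (λ a →
             ≈-trans (sum-distribʳ _ _ V) (sum-cong V (λ w → *-assoc _ _ _)))) ⟩
      exit v u + sumOver V (λ a → sumOver V (λ w → A u w * (G w a * exit v a)))
        ≈⟨ +-congˡ (sum-swap _ V V) ⟩
      exit v u + sumOver V (λ w → sumOver V (λ a → A u w * (G w a * exit v a)))
        ≈⟨ +-congˡ (sum-cong V (λ w → sum-distribˡ (A u w) _ V)) ⟨
      exit v u + sumOver V (λ w → A u w * cutSum v w) ∎
      where V = allFin S

    exit-inside : ∀ v {u} → T u → exit v u ≈ sumOver (allFin S) (λ b → A u b * crossing v b)
    exit-inside v {u} u∈T with T? u
    ... | yes _   = ≈-refl
    ... | no  u∉T = contradiction u∈T u∉T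

    cutSum-inside : ∀ {v} → ¬ T v → ∀ {u} → Acc _<_ (rank u) → T u → G u v ≈ cutSum v u
    cutSum-inside {v} v∉T {u} (acc rs) u∈T = begin
      G u v
        ≈⟨ G-unfold u v ⟩
      δ u v + sumOver V (λ w → A u w * G w v)
        ≈⟨ +-cong δ≈0 (sum-cong V step) ⟩
      0# + sumOver V (λ w → A u w * crossing v w + A u w * cutSum v w)
        ≈⟨ ≈-trans (+-identityˡ _) (sum-+ _ _ V) ⟩
      sumOver V (λ w → A u w * crossing v w) + sumOver V (λ w → A u w * cutSum v w)
        ≈⟨ +-congʳ (exit-inside v u∈T) ⟨
      exit v u + sumOver V (λ w → A u w * cutSum v w)
        ≈⟨ cutSum-unfold v u ⟨
      cutSum v u ∎
      where
      V = allFin S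

      δ≈0 : δ u v ≈ 0#
      δ≈0 with u ≟F v
      ... | yes refl = contradiction u∈T v∉T
      ... | no  _    = ≈-refl

      split : ∀ w → rank w < rank u → G w v ≈ crossing v w + cutSum v w
      split w w<u with T? w
      ... | yes w∈T = ≈-trans (cutSum-inside v∉T (rs w<u) w∈T) (≈-sym (+-identityˡ _))
      ... | no  w∉T = ≈-trans (≈-sym (+-identityʳ _)) (+-congˡ (≈-sym (cutSum-outside v w∉T)))

      step : ∀ w → A u w * G w v ≈ A u w * crossing v w + A u w * cutSum v w
      step w with A-ranked u w
      ... | inj₂ w<u = ≈-trans (*-congˡ (split w w<u)) (distribˡ _ _ _)
      ... | inj₁ A≈0 = begin
        A u w * G w v                                ≈⟨ vanishes ⟩
        0#                                           ≈⟨ +-identityˡ 0# ⟨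
        0# + 0#                                      ≈⟨ +-cong vanishes vanishes ⟨
        A u w * crossing v w + A u w * cutSum v w    ∎
        where
        vanishes : ∀ {y} → A u w * y ≈ 0#
        vanishes = ≈-trans (*-congʳ A≈0) (zeroˡ _)

    -- Every walk that leaves T does so along exactly one edge.
    cut : ∀ {u v} → T u → ¬ T v →
          G u v ≈ sumOver (allFin S) (λ a → sumOver (allFin S) (λ b →
                    if ⌊ T? a ⌋ then (if ⌊ T? b ⌋ then 0# else G u a * (A a b * G b v)) else 0#))
    cut {u} {v} u∈T v∉T = ≈-trans (cutSum-inside v∉T (<-wellFounded _) u∈T) (sum-cong (allFin S) expand)
      where
      expand : ∀ a → G u a * exit v a ≈ sumOver (allFin S) (λ b →
                 if ⌊ T? a ⌋ then (if ⌊ T? b ⌋ then 0# else G u a * (A a b * G b v)) else 0#)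
      expand a with T? a
      ... | no  _ = ≈-trans (zeroʳ _) (≈-sym (sum-zero (allFin S) (λ _ → ≈-refl)))
      ... | yes _ = ≈-trans (sum-distribˡ _ _ (allFin S)) (sum-cong (allFin S) term)
        where
        term : ∀ b → G u a * (A a b * crossing v b) ≈ (if ⌊ T? b ⌋ then 0# else G u a * (A a b * G b v))
        term b with T? b
        ... | yes _ = ≈-trans (*-congˡ (zeroʳ _)) (zeroʳ _)
        ... | no  _ = ≈-refl

open import Data.Nat.Base
  using (_+_; _*_; _∸_; _^_; _⊔_; _≤_; z≤n; s≤s; s≤s⁻¹; ⌊_/2⌋; ⌈_/2⌉; >-nonZero)
open import Data.Nat.Properties
  using ( +-assoc; +-comm; +-identityˡ; +-identityʳ; +-suc; +-cancelˡ-≡; +-cancelˡ-≤; +-mono-≤; +-monoˡ-≤; +-monoʳ-≤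
        ; *-assoc; *-identityʳ; *-suc; *-mono-≤; *-monoˡ-≤; *-monoʳ-≤; ^-monoʳ-≤; m^n>0; ∸-monoʳ-<; ⊔-lub
        ; ≤-refl; ≤-reflexive; ≤-trans; ≤-<-trans; <-trans; <-irrefl; <⇒≤; <⇒≱; ≤⇒≯; ≰⇒>; _≤?_; module ≤-Reasoning
        ; m≤m+n; m≤n+m; m≤n⇒m≤1+n; n≤1+n; n≤0⇒n≡0
        ; ⌊n/2⌋-mono; ⌈n/2⌉-mono; ⌊n/2⌋+⌈n/2⌉≡n; n≡⌊n+n/2⌋; n≡⌈n+n/2⌉; ⌊n/2⌋<n
        )
  renaming (_≟_ to _≟ℕ_)

-- The semiring of polynomials

module PolySemiring {a ℓ₁ ℓ₂} (𝔽 : HeytingField a ℓ₁ ℓ₂) (n : ℕ) where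

  open Multilinear 𝔽 n

  𝔽-ring : CommutativeRing a ℓ₁
  𝔽-ring = HeytingCommutativeRing.commutativeRing (HeytingField.heytingCommutativeRing 𝔽)

  private module F = CommutativeRing 𝔽-ring
  open ListSum F.semiring
  open SetoidReasoning F.setoid

  _⊕_ : Monomial → Monomial → Monomial
  _⊕_ = zipWith _+_

  eval : (Monomial → F.Carrier) → Poly → F.Carrier
  eval φ p = sumOver p (λ t → proj₁ t F.* φ (proj₂ t))

  infix 4 _≋_

  -- Finer than _≈ₚ_ on its face, and a congruence by construction.
  record _≋_ (p q : Poly) : Set (a ⊔ˡ ℓ₁) where
    constructor pointwise
    field
      at : ∀ φ → eval φ p F.≈ eval φ q

  open _≋_ public

  eval-cong : ∀ {φ ψ} p → (∀ α → φ α F.≈ ψ α) → eval φ p F.≈ eval ψ p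
  eval-cong p φ≈ψ = sum-cong p (λ t → F.*-congˡ (φ≈ψ (proj₂ t)))

  eval-++ : ∀ φ p q → eval φ (p ++ q) F.≈ eval φ p F.+ eval φ q
  eval-++ φ = sum-++ _

  eval-*ₚ : ∀ φ p q → eval φ (p *ₚ q) F.≈ eval (λ α → eval (λ β → φ (α ⊕ β)) q) p
  eval-*ₚ φ p q = begin
    eval φ (p *ₚ q)
      ≈⟨ sum-cartesianProductWith _ _ p q ⟩
    sumOver p (λ s → sumOver q (λ t → (proj₁ s F.* proj₁ t) F.* φ (proj₂ s ⊕ proj₂ t)))
      ≈⟨ sum-cong p (λ s → F.trans (sum-cong q (λ t → F.*-assoc _ _ _)) (F.sym (sum-distribˡ _ _ q))) ⟩
    eval (λ α → eval (λ β → φ (α ⊕ β)) q) p ∎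

  eval-zero : ∀ p → eval (λ _ → F.0#) p F.≈ F.0#
  eval-zero p = sum-zero p (λ t → F.zeroʳ _)

  eval-+ : ∀ φ ψ p → eval (λ α → φ α F.+ ψ α) p F.≈ eval φ p F.+ eval ψ p
  eval-+ φ ψ p = F.trans (sum-cong p (λ t → F.distribˡ _ _ _)) (sum-+ _ _ p)

  eval-const : ∀ φ c → eval φ (constₚ c) F.≈ c F.* φ (replicate n 0)
  eval-const φ c = F.+-identityʳ _

  ++-cong : ∀ {p p′ q q′} → p ≋ p′ → q ≋ q′ → p ++ q ≋ p′ ++ q′
  ++-cong {p} {p′} {q} {q′} p≋p′ q≋q′ = pointwise λ φ →
    F.trans (eval-++ φ p q) (F.trans (F.+-cong (at p≋p′ φ) (at q≋q′ φ)) (F.sym (eval-++ φ p′ q′)))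

  *ₚ-cong : ∀ {p p′ q q′} → p ≋ p′ → q ≋ q′ → p *ₚ q ≋ p′ *ₚ q′
  *ₚ-cong {p} {p′} {q} {q′} p≋p′ q≋q′ = pointwise λ φ → begin
    eval φ (p *ₚ q)                              ≈⟨ eval-*ₚ φ p q ⟩
    eval (λ α → eval (λ β → φ (α ⊕ β)) q) p      ≈⟨ at p≋p′ _ ⟩
    eval (λ α → eval (λ β → φ (α ⊕ β)) q) p′     ≈⟨ eval-cong p′ (λ α → at q≋q′ _) ⟩
    eval (λ α → eval (λ β → φ (α ⊕ β)) q′) p′    ≈⟨ eval-*ₚ φ p′ q′ ⟨
    eval φ (p′ *ₚ q′)                            ∎

  *ₚ-assoc : ∀ p q r → (p *ₚ q) *ₚ r ≋ p *ₚ (q *ₚ r)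
  *ₚ-assoc p q r = pointwise λ φ → begin
    eval φ ((p *ₚ q) *ₚ r)
      ≈⟨ eval-*ₚ φ (p *ₚ q) r ⟩
    eval (λ α → eval (λ γ → φ (α ⊕ γ)) r) (p *ₚ q)
      ≈⟨ eval-*ₚ _ p q ⟩
    eval (λ α → eval (λ β → eval (λ γ → φ ((α ⊕ β) ⊕ γ)) r) q) p
      ≈⟨ eval-cong p (λ α → eval-cong q (λ β → eval-cong r (λ γ →
           F.reflexive (cong φ (zipWith-assoc +-assoc α β γ))))) ⟩
    eval (λ α → eval (λ β → eval (λ γ → φ (α ⊕ (β ⊕ γ))) r) q) p
      ≈⟨ eval-cong p (λ α → eval-*ₚ _ q r) ⟨
    eval (λ α → eval (λ β → φ (α ⊕ β)) (q *ₚ r)) p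
      ≈⟨ eval-*ₚ φ p (q *ₚ r) ⟨
    eval φ (p *ₚ (q *ₚ r)) ∎

  *ₚ-identityˡ : ∀ p → constₚ F.1# *ₚ p ≋ p
  *ₚ-identityˡ p = pointwise λ φ → begin
    eval φ (constₚ F.1# *ₚ p)                    ≈⟨ eval-*ₚ φ (constₚ F.1#) p ⟩
    _                                            ≈⟨ eval-const (λ α → eval (λ β → φ (α ⊕ β)) p) F.1# ⟩
    F.1# F.* eval (λ β → φ (replicate n 0 ⊕ β)) p ≈⟨ F.*-identityˡ _ ⟩
    eval (λ β → φ (replicate n 0 ⊕ β)) p
      ≈⟨ eval-cong p (λ β → F.reflexive (cong φ (zipWith-identityˡ +-identityˡ β))) ⟩
    eval φ p                                     ∎

  *ₚ-identityʳ : ∀ p → p *ₚ constₚ F.1# ≋ p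
  *ₚ-identityʳ p = pointwise λ φ → begin
    eval φ (p *ₚ constₚ F.1#)                    ≈⟨ eval-*ₚ φ p (constₚ F.1#) ⟩
    eval (λ α → eval (λ β → φ (α ⊕ β)) (constₚ F.1#)) p
      ≈⟨ eval-cong p (λ α → F.trans (eval-const (λ β → φ (α ⊕ β)) F.1#) (F.*-identityˡ _)) ⟩
    eval (λ α → φ (α ⊕ replicate n 0)) p
      ≈⟨ eval-cong p (λ α → F.reflexive (cong φ (zipWith-identityʳ +-identityʳ α))) ⟩
    eval φ p                                     ∎

  *ₚ-distribˡ : ∀ p q r → p *ₚ (q ++ r) ≋ p *ₚ q ++ p *ₚ r
  *ₚ-distribˡ p q r = pointwise λ φ → begin
    eval φ (p *ₚ (q ++ r))
      ≈⟨ eval-*ₚ φ p (q ++ r) ⟩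
    eval (λ α → eval (λ β → φ (α ⊕ β)) (q ++ r)) p
      ≈⟨ F.trans (eval-cong p (λ α → eval-++ _ q r)) (eval-+ _ _ p) ⟩
    eval (λ α → eval (λ β → φ (α ⊕ β)) q) p F.+ eval (λ α → eval (λ β → φ (α ⊕ β)) r) p
      ≈⟨ F.+-cong (eval-*ₚ φ p q) (eval-*ₚ φ p r) ⟨
    eval φ (p *ₚ q) F.+ eval φ (p *ₚ r)
      ≈⟨ eval-++ φ (p *ₚ q) (p *ₚ r) ⟨
    eval φ (p *ₚ q ++ p *ₚ r) ∎

  *ₚ-distribʳ : ∀ p q r → (q ++ r) *ₚ p ≋ q *ₚ p ++ r *ₚ p
  *ₚ-distribʳ p q r = pointwise λ φ → begin
    eval φ ((q ++ r) *ₚ p)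
      ≈⟨ F.trans (eval-*ₚ φ (q ++ r) p) (eval-++ _ q r) ⟩
    eval (λ α → eval (λ β → φ (α ⊕ β)) p) q F.+ eval (λ α → eval (λ β → φ (α ⊕ β)) p) r
      ≈⟨ F.+-cong (eval-*ₚ φ q p) (eval-*ₚ φ r p) ⟨
    eval φ (q *ₚ p) F.+ eval φ (r *ₚ p)
      ≈⟨ eval-++ φ (q *ₚ p) (r *ₚ p) ⟨
    eval φ (q *ₚ p ++ r *ₚ p) ∎

  polySemiring : Semiring a (a ⊔ˡ ℓ₁)
  polySemiring = record
    { Carrier = Poly
    ; _≈_     = _≋_
    ; _+_     = _+ₚ_
    ; _*_     = _*ₚ_
    ; 0#      = []
    ; 1#      = constₚ F.1#
    ; isSemiring = record
      { isSemiringWithoutAnnihilatingZero = record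
        { +-isCommutativeMonoid = record
          { isMonoid = record
            { isSemigroup = record
              { isMagma = record
                { isEquivalence = record
                  { refl  = pointwise λ φ → F.refl
                  ; sym   = λ p≋q → pointwise λ φ → F.sym (at p≋q φ)
                  ; trans = λ p≋q q≋r → pointwise λ φ → F.trans (at p≋q φ) (at q≋r φ)
                  }
                ; ∙-cong = ++-cong
                }
              ; assoc = λ p q r → pointwise λ φ → F.reflexive (cong (eval φ) (++-assoc p q r))
              }
            ; identity = (λ p → pointwise λ φ → F.refl)
                       , (λ p → pointwise λ φ → F.reflexive (cong (eval φ) (++-identityʳ p)))
            }
          ; comm = λ p q → pointwise λ φ → F.trans (eval-++ φ p q) (F.trans (F.+-comm _ _) (F.sym (eval-++ φ q p)))
          }
        ; *-cong     = *ₚ-cong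
        ; *-assoc    = *ₚ-assoc
        ; *-identity = *ₚ-identityˡ , *ₚ-identityʳ
        ; distrib    = *ₚ-distribˡ , *ₚ-distribʳ
        }
      ; zero = (λ p → pointwise λ φ → F.refl)
             , (λ p → pointwise λ φ → F.trans (eval-*ₚ φ p []) (eval-zero p))
      }
    }

  ≋⇒≈ₚ : ∀ {p q} → p ≋ q → p ≈ₚ q
  ≋⇒≈ₚ {p} {q} p≋q α = F.trans (coeff-eval p) (F.trans (at p≋q indicator) (F.sym (coeff-eval q)))
    where
    indicator : Monomial → F.Carrier
    indicator β = if ⌊ ≡-dec _≟ℕ_ β α ⌋ then F.1# else F.0#

    coeff-eval : ∀ p → coeff p α F.≈ eval indicator p
    coeff-eval []            = F.refl
    coeff-eval ((c , β) ∷ p) = F.+-cong term (coeff-eval p)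
      where
      term : (if ⌊ ≡-dec _≟ℕ_ β α ⌋ then c else F.0#) F.≈ c F.* indicator β
      term with ≡-dec _≟ℕ_ β α
      ... | yes _ = F.sym (F.*-identityʳ c)
      ... | no  _ = F.sym (F.zeroʳ c)

-- Walks in a program

∈⋃⁺ : ∀ {n} {x : Fin n} {ps} → Any (x ∈ₛ_) ps → x ∈ₛ ⋃ ps
∈⋃⁺ (here x∈p)   = x∈p∪q⁺ (inj₁ x∈p)
∈⋃⁺ (there x∈ps) = x∈p∪q⁺ (inj₂ (∈⋃⁺ x∈ps))

∈⋃⁻ : ∀ {n} {x : Fin n} ps → x ∈ₛ ⋃ ps → Any (x ∈ₛ_) ps
∈⋃⁻ []       x∈ = contradiction x∈ ∉⊥
∈⋃⁻ (p ∷ ps) x∈ with x∈p∪q⁻ p (⋃ ps) x∈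
... | inj₁ x∈p  = here x∈p
... | inj₂ x∈ps = there (∈⋃⁻ ps x∈ps)

module ProgramPaths {a ℓ₁ ℓ₂} (𝔽 : HeytingField a ℓ₁ ℓ₂) (n : ℕ) (P : Multilinear.ABP 𝔽 n) where

  open Multilinear 𝔽 n
  open PolySemiring 𝔽 n
  open ABP P using (size; ℓ; layer) renaming (edge to edgeᴾ; layered to layeredᴾ)
  open ListSum polySemiring
  private module R = Semiring polySemiring

  infix 4 _⊑_
  _⊑_ : Edges size → Edges size → Set a
  E ⊑ E′ = ∀ {u v x} → E u v ≡ just x → E′ u v ≡ just x

  infixr 5 _∷_
  data Walk (E : Edges size) : Fin size → List Label → Fin size → Set a where
    []  : ∀ {u} → Walk E u [] u
    _∷_ : ∀ {u w v x π} → E u w ≡ just x → Walk E w π v → Walk E u (x ∷ π) v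

  walk-mono : ∀ {E E′ u π v} → E ⊑ E′ → Walk E u π v → Walk E′ u π v
  walk-mono E⊑E′ []      = []
  walk-mono E⊑E′ (e ∷ p) = E⊑E′ e ∷ walk-mono E⊑E′ p

  infixr 5 _++ʷ_
  _++ʷ_ : ∀ {E u π w ρ v} → Walk E u π w → Walk E w ρ v → Walk E u (π ++ ρ) v
  []      ++ʷ q = q
  (e ∷ p) ++ʷ q = e ∷ (p ++ʷ q)

  edgePoly : Maybe Label → Poly
  edgePoly = maybe′ labelPoly []

  walkPoly : List Label → Poly
  walkPoly π = ∏ (map labelPoly π)

  module Walks (E : Edges size) (E⊑P : E ⊑ edgeᴾ) where

    open Paths ℓ E public

    layered : ∀ {u v x} → E u v ≡ just x → toℕ (layer v) ≡ suc (toℕ (layer u))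
    layered e = layeredᴾ (E⊑P e)

    walk-layer : ∀ {u π v} → Walk E u π v → toℕ (layer u) + length π ≡ toℕ (layer v)
    walk-layer []                  = +-identityʳ _
    walk-layer {u} (_∷_ {π = π} e p) =
      trans (+-suc (toℕ (layer u)) (length π)) (trans (cong (_+ length π) (sym (layered e))) (walk-layer p))

    ∈-pathsOfLength⁺ : ∀ {u π v} → Walk E u π v → π ∈ pathsOfLength (length π) u v
    ∈-pathsOfLength⁺ {u} [] with u ≟F u
    ... | yes _   = here refl
    ... | no  u≢u = contradiction refl u≢u
    ∈-pathsOfLength⁺ {u} (_∷_ {w = w} {v} {x} {π} e p) =
      ∈-concatMap⁺ _ (lose (∈-allFin w) (extend (E u w) e))
      where
      extend : ∀ y → y ≡ just x →
               x ∷ π ∈ maybe′ (λ x → map (x ∷_) (pathsOfLength (length π) w v)) [] y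
      extend _ refl = ∈-map⁺ (x ∷_) (∈-pathsOfLength⁺ p)

    ∈-pathsOfLength⁻ : ∀ k {u π v} → π ∈ pathsOfLength k u v → Walk E u π v × length π ≡ k
    ∈-pathsOfLength⁻ zero {u} {π} {v} π∈ with u ≟F v | π∈
    ... | yes refl | here refl = [] , refl
    ∈-pathsOfLength⁻ (suc k) {u} {π} {v} π∈
      with find (∈-concatMap⁻ (λ w → maybe′ (λ x → map (x ∷_) (pathsOfLength k w v)) [] (E u w)) {xs = allFin size} π∈)
    ... | w , _ , π∈w with E u w in e
    ... | just x with ∈-map⁻ (x ∷_) π∈w
    ... | ρ , ρ∈ , refl with ∈-pathsOfLength⁻ k ρ∈
    ... | q , refl = e ∷ q , refl

    ∈-paths⁺ : ∀ {u π v} → Walk E u π v → π ∈ paths u v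
    ∈-paths⁺ {u} {π} {v} p = ∈-concatMap⁺ _ (lose (∈-upTo⁺ (s≤s length≤ℓ)) (∈-pathsOfLength⁺ p))
      where
      length≤ℓ : length π ≤ ℓ
      length≤ℓ = ≤-trans (m≤n+m _ (toℕ (layer u)))
                         (≤-trans (≤-reflexive (walk-layer p)) (s≤s⁻¹ (toℕ<n (layer v))))

    ∈-paths⁻ : ∀ {u π v} → π ∈ paths u v → Walk E u π v
    ∈-paths⁻ {u} {π} {v} π∈ with find (∈-concatMap⁻ (λ k → pathsOfLength k u v) {xs = upTo (suc ℓ)} π∈)
    ... | k , _ , π∈k = proj₁ (∈-pathsOfLength⁻ k π∈k)

    no-loop : ∀ {u π} → Walk E u π u → π ≡ []
    no-loop {u} {[]}    p = refl
    no-loop {u} {x ∷ π} p with +-cancelˡ-≡ (toℕ (layer u)) _ _ (trans (walk-layer p) (sym (+-identityʳ _)))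
    ... | ()

    ∈-pathVars⁺ : ∀ {u π v i} → Walk E u π v → i ∈ variables π → i ∈ₛ pathVars u v
    ∈-pathVars⁺ p i∈π =
      ∈⋃⁺ (Any-map⁺ (lose (∈-paths⁺ p) (∈⋃⁺ (Any-map⁺ (Any.map (λ where refl → x∈⁅x⁆ _) i∈π)))))

    ∈-pathVars⁻ : ∀ u v {i} → i ∈ₛ pathVars u v → ∃ λ π → Walk E u π v × i ∈ variables π
    ∈-pathVars⁻ u v i∈ with find (Any-map⁻ (∈⋃⁻ (map _ (paths u v)) i∈))
    ... | π , π∈ , i∈π = π , ∈-paths⁻ π∈ , Any.map (x∈⁅y⁆⇒x≡y _) (Any-map⁻ (∈⋃⁻ (map ⁅_⁆ (variables π)) i∈π))

    pathVars-extendʳ : ∀ {u w π v} → Walk E w π v → pathVars u w ⊆ pathVars u v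
    pathVars-extendʳ {u} {w} {π} q i∈ with ∈-pathVars⁻ u w i∈
    ... | ρ , p , i∈ρ = ∈-pathVars⁺ (p ++ʷ q) (subst (_ ∈_) (sym (mapMaybe-++ variable? ρ π)) (∈-++⁺ˡ i∈ρ))

    pathVars-extendˡ : ∀ {u π w v} → Walk E u π w → pathVars w v ⊆ pathVars u v
    pathVars-extendˡ {π = π} {w} {v} p i∈ with ∈-pathVars⁻ w v i∈
    ... | ρ , q , i∈ρ = ∈-pathVars⁺ (p ++ʷ q) (subst (_ ∈_) (sym (mapMaybe-++ variable? π ρ)) (∈-++⁺ʳ (variables π) i∈ρ))

    ∣pathVars-loop∣≡0 : ∀ u → ∣ pathVars u u ∣ ≡ 0
    ∣pathVars-loop∣≡0 u = n≤0⇒n≡0 (subst (∣ pathVars u u ∣ ≤_) (∣⊥∣≡0 n) (p⊆q⇒∣p∣≤∣q∣ loop⊆∅))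
      where
      loop⊆∅ : pathVars u u ⊆ ∅
      loop⊆∅ i∈ with ∈-pathVars⁻ u u i∈
      ... | π , p , i∈π with no-loop p
      loop⊆∅ i∈ | .[] , p , () | refl

    walkSum : ℕ → Fin size → Fin size → Poly
    walkSum k u v = sumOver (pathsOfLength k u v) walkPoly

    walkSum-zero : ∀ u v → walkSum 0 u v ≡ δ u v
    walkSum-zero u v with u ≟F v
    ... | yes _ = refl
    ... | no  _ = refl

    walkSum-suc : ∀ k u v → walkSum (suc k) u v ≋ sumOver (allFin size) (λ w → edgePoly (E u w) *ₚ walkSum k w v)
    walkSum-suc k u v = R.trans (sum-concatMap _ walkPoly (allFin size)) (sum-cong (allFin size) λ w → first (E u w) w)
      where
      first : ∀ y w → sumOver (maybe′ (λ x → map (x ∷_) (pathsOfLength k w v)) [] y) walkPoly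
                      ≋ edgePoly y *ₚ walkSum k w v
      first nothing  w = R.refl
      first (just x) w = R.trans (R.reflexive (sum-map (x ∷_) walkPoly (pathsOfLength k w v)))
                                 (R.sym (sum-distribˡ (labelPoly x) walkPoly (pathsOfLength k w v)))

    walkSum-overlong : ∀ {u w v x} → E u w ≡ just x → walkSum ℓ w v ≡ []
    walkSum-overlong {u} {w} {v} e with pathsOfLength ℓ w v in eq
    ... | []    = refl
    ... | π ∷ _ with ∈-pathsOfLength⁻ ℓ {w} {π} {v} (subst (π ∈_) (sym eq) (here refl))
    ... | p , refl = contradiction
      (≤-trans (≤-reflexive (trans (cong (_+ length π) (sym (layered e))) (walk-layer p))) (s≤s⁻¹ (toℕ<n (layer v))))
      (λ 1+u+ℓ≤ℓ → <-irrefl refl (≤-trans (s≤s (m≤n+m (length π) (toℕ (layer u)))) 1+u+ℓ≤ℓ))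

    pathPoly-walkSum : ∀ u v → pathPoly u v ≋ sumOver (upTo (suc ℓ)) (λ k → walkSum k u v)
    pathPoly-walkSum u v = sum-concatMap (λ k → pathsOfLength k u v) walkPoly (upTo (suc ℓ))

    edge-walkSum : ∀ u w v → edgePoly (E u w) *ₚ sumOver (upTo ℓ) (λ k → walkSum k w v)
                             ≋ edgePoly (E u w) *ₚ pathPoly w v
    edge-walkSum u w v with E u w in e
    ... | nothing = R.refl
    ... | just x  = R.*-congˡ {labelPoly x} (begin
      sumOver (upTo ℓ) W                ≈⟨ R.+-identityʳ _ ⟨
      sumOver (upTo ℓ) W +ₚ []          ≈⟨ R.+-congˡ (R.reflexive (cong (_++ []) (walkSum-overlong e))) ⟨
      sumOver (upTo ℓ) W +ₚ (W ℓ +ₚ []) ≈⟨ sum-++ W (upTo ℓ) [ ℓ ] ⟨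
      sumOver (upTo ℓ ++ [ ℓ ]) W       ≡⟨ cong (λ ks → sumOver ks W) (upTo-∷ʳ ℓ) ⟩
      sumOver (upTo (suc ℓ)) W          ≈⟨ pathPoly-walkSum w v ⟨
      pathPoly w v                      ∎)
      where
      open SetoidReasoning R.setoid
      W : ℕ → Poly
      W k = walkSum k w v

    pathPoly-unfold : ∀ u v → pathPoly u v ≋ δ u v +ₚ sumOver (allFin size) (λ w → edgePoly (E u w) *ₚ pathPoly w v)
    pathPoly-unfold u v = begin
      pathPoly u v
        ≈⟨ pathPoly-walkSum u v ⟩
      walkSum 0 u v +ₚ sumOver (applyUpTo suc ℓ) (λ k → walkSum k u v)
        ≡⟨ cong₂ _+ₚ_ (walkSum-zero u v) (cong (λ ks → sumOver ks (λ k → walkSum k u v)) (sym (map-upTo suc ℓ))) ⟩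
      δ u v +ₚ sumOver (map suc (upTo ℓ)) (λ k → walkSum k u v)
        ≡⟨ cong (δ u v +ₚ_) (sum-map suc _ (upTo ℓ)) ⟩
      δ u v +ₚ sumOver (upTo ℓ) (λ k → walkSum (suc k) u v)
        ≈⟨ R.+-congˡ (R.trans (sum-cong (upTo ℓ) (λ k → walkSum-suc k u v)) (sum-swap _ (upTo ℓ) V)) ⟩
      δ u v +ₚ sumOver V (λ w → sumOver (upTo ℓ) (λ k → edgePoly (E u w) *ₚ walkSum k w v))
        ≈⟨ R.+-congˡ (sum-cong V (λ w → R.trans
             (R.sym (sum-distribˡ (edgePoly (E u w)) (λ k → walkSum k w v) (upTo ℓ)))
             (edge-walkSum u w v))) ⟩
      δ u v +ₚ sumOver V (λ w → edgePoly (E u w) *ₚ pathPoly w v) ∎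
      where
      open SetoidReasoning R.setoid
      V = allFin size

    rank : Fin size → ℕ
    rank u = ℓ ∸ toℕ (layer u)

    edgePoly-ranked : ∀ u w → edgePoly (E u w) ≋ [] ⊎ rank w < rank u
    edgePoly-ranked u w with E u w in e
    ... | nothing = inj₁ R.refl
    ... | just x  = inj₂ (∸-monoʳ-< (≤-reflexive (sym (layered e))) (s≤s⁻¹ (toℕ<n (layer w))))

-- Splitting at the frontier

∣p∪q∣≤∣p∣+∣q∣ : ∀ {n} (p q : Subset n) → ∣ p ∪ q ∣ ≤ ∣ p ∣ + ∣ q ∣
∣p∪q∣≤∣p∣+∣q∣ Vec.[]              Vec.[]              = z≤n
∣p∪q∣≤∣p∣+∣q∣ (outside Vec.∷ p) (outside Vec.∷ q) = ∣p∪q∣≤∣p∣+∣q∣ p q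
∣p∪q∣≤∣p∣+∣q∣ (outside Vec.∷ p) (inside  Vec.∷ q) =
  ≤-trans (s≤s (∣p∪q∣≤∣p∣+∣q∣ p q)) (≤-reflexive (sym (+-suc ∣ p ∣ ∣ q ∣)))
∣p∪q∣≤∣p∣+∣q∣ (inside  Vec.∷ p) (outside Vec.∷ q) = s≤s (∣p∪q∣≤∣p∣+∣q∣ p q)
∣p∪q∣≤∣p∣+∣q∣ (inside  Vec.∷ p) (inside  Vec.∷ q) =
  s≤s (≤-trans (∣p∪q∣≤∣p∣+∣q∣ p q) (+-monoʳ-≤ ∣ p ∣ (n≤1+n ∣ q ∣)))

disjoint⇒∣p∣+∣q∣≤∣p∪q∣ : ∀ {n} (p q : Subset n) → Empty (p ∩ q) → ∣ p ∣ + ∣ q ∣ ≤ ∣ p ∪ q ∣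
disjoint⇒∣p∣+∣q∣≤∣p∪q∣ Vec.[]              Vec.[]              _  = z≤n
disjoint⇒∣p∣+∣q∣≤∣p∪q∣ (outside Vec.∷ p) (outside Vec.∷ q) p∥q = disjoint⇒∣p∣+∣q∣≤∣p∪q∣ p q (drop-∷-Empty p∥q)
disjoint⇒∣p∣+∣q∣≤∣p∪q∣ (outside Vec.∷ p) (inside  Vec.∷ q) p∥q =
  ≤-trans (≤-reflexive (+-suc ∣ p ∣ ∣ q ∣)) (s≤s (disjoint⇒∣p∣+∣q∣≤∣p∪q∣ p q (drop-∷-Empty p∥q)))
disjoint⇒∣p∣+∣q∣≤∣p∪q∣ (inside  Vec.∷ p) (outside Vec.∷ q) p∥q = s≤s (disjoint⇒∣p∣+∣q∣≤∣p∪q∣ p q (drop-∷-Empty p∥q))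
disjoint⇒∣p∣+∣q∣≤∣p∪q∣ (inside  Vec.∷ p) (inside  Vec.∷ q) p∥q = contradiction (zero , Vec.here) p∥q

unique-++⁻ˡ : ∀ {a} {A : Set a} (xs : List A) {ys} → Unique (xs ++ ys) → Unique xs
unique-++⁻ˡ []       _          = []
unique-++⁻ˡ (x ∷ xs) (x∉ ∷ xs!) = ++⁻ˡ xs x∉ ∷ unique-++⁻ˡ xs xs!

unique-++⁻ʳ : ∀ {a} {A : Set a} (xs : List A) {ys} → Unique (xs ++ ys) → Unique ys
unique-++⁻ʳ []       xs!       = xs!
unique-++⁻ʳ (x ∷ xs) (_ ∷ xs!) = unique-++⁻ʳ xs xs!

unique-++⇒disjoint : ∀ {a} {A : Set a} {xs ys : List A} {x} → Unique (xs ++ ys) → x ∈ xs → ¬ x ∈ ys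
unique-++⇒disjoint {xs = x ∷ xs} (x∉ ∷ _)   (here refl) x∈ys = All.lookup x∉ (∈-++⁺ʳ xs x∈ys) refl
unique-++⇒disjoint {xs = x ∷ xs} (_ ∷ xs!) (there x∈xs) x∈ys = unique-++⇒disjoint xs! x∈xs x∈ys

inhabited? : ∀ {a} {A : Set a} (xs : List A) → Dec (∃ λ x → x ∈ xs)
inhabited? []      = no λ ()
inhabited? (x ∷ _) = yes (x , here refl)

just? : ∀ {a} {A : Set a} (y : Maybe A) → Dec (∃ λ x → y ≡ just x)
just? (just x) = yes (x , refl)
just? nothing  = no λ ()

module Splitting {a ℓ₁ ℓ₂} (𝔽 : HeytingField a ℓ₁ ℓ₂) (n : ℕ) (P : Multilinear.ABP 𝔽 n) where

  open Multilinear 𝔽 n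
  open PolySemiring 𝔽 n
  open ABP P using (size; ℓ; layer) renaming (edge to edgeᴾ)
  open ListSum polySemiring
  open ProgramPaths 𝔽 n P
  private module R = Semiring polySemiring

  module OnlyEdge (E : Edges size) (E⊑P : E ⊑ edgeᴾ) (c d : Fin size) where

    open Walks E E⊑P

    onlyEdge : Edges size
    onlyEdge u v with u ≟F c | v ≟F d
    ... | no  _ | _     = E u v
    ... | yes _ | yes _ = E u v
    ... | yes _ | no  _ = nothing

    onlyEdge⊑ : onlyEdge ⊑ E
    onlyEdge⊑ {u} {v} e with u ≟F c | v ≟F d
    ... | no  _ | _     = e
    ... | yes _ | yes _ = e

    onlyEdge-away : ∀ {u} v → u ≢ c → onlyEdge u v ≡ E u v
    onlyEdge-away {u} v u≢c with u ≟F c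
    ... | yes u≡c = contradiction u≡c u≢c
    ... | no  _   = refl

    onlyEdge-at : ∀ {v x} → onlyEdge c v ≡ just x → v ≡ d
    onlyEdge-at {v} e with c ≟F c | v ≟F d
    ... | no c≢c | _       = contradiction refl c≢c
    ... | yes _  | yes v≡d = v≡d

    private module W′ = Walks onlyEdge (E⊑P ∘ onlyEdge⊑)

    pathsOfLength-after : ∀ k w v → toℕ (layer c) < toℕ (layer w) → W′.pathsOfLength k w v ≡ pathsOfLength k w v
    pathsOfLength-after zero    w v c<w = refl
    pathsOfLength-after (suc k) w v c<w = concatMap-cong next (allFin size)
      where
      next : ∀ z → maybe′ (λ x → map (x ∷_) (W′.pathsOfLength k z v)) [] (onlyEdge w z)
                 ≡ maybe′ (λ x → map (x ∷_) (pathsOfLength k z v)) [] (E w z)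
      next z rewrite onlyEdge-away z (λ w≡c → <-irrefl (cong (toℕ ∘ layer) (sym w≡c)) c<w) with E w z in e
      ... | nothing = refl
      ... | just x  = cong (map (x ∷_)) (pathsOfLength-after k z v (<-trans c<w (≤-reflexive (sym (layered e)))))

    pathPoly-after : ∀ w v → toℕ (layer c) < toℕ (layer w) → W′.pathPoly w v ≡ pathPoly w v
    pathPoly-after w v c<w =
      cong (λ πs → sumOver πs walkPoly) (concatMap-cong (λ k → pathsOfLength-after k w v c<w) (upTo (suc ℓ)))

    pathPoly-onlyEdge : ∀ {v x} → c ≢ v → E c d ≡ just x → W′.pathPoly c v ≋ edgePoly (E c d) *ₚ pathPoly d v
    pathPoly-onlyEdge {v} {x} c≢v e = begin
      W′.pathPoly c v
        ≈⟨ W′.pathPoly-unfold c v ⟩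
      δ c v +ₚ sumOver V (λ w → edgePoly (onlyEdge c w) *ₚ W′.pathPoly w v)
        ≈⟨ R.+-cong δ≈0 (sum-cong V term) ⟩
      sumOver V (λ w → δ d w *ₚ (edgePoly (E c w) *ₚ pathPoly w v))
        ≈⟨ sum-δ d _ ⟩
      edgePoly (E c d) *ₚ pathPoly d v ∎
      where
      open SetoidReasoning R.setoid
      V = allFin size

      δ≈0 : δ c v ≋ []
      δ≈0 with c ≟F v
      ... | yes c≡v = contradiction c≡v c≢v
      ... | no  _   = R.refl

      term : ∀ w → edgePoly (onlyEdge c w) *ₚ W′.pathPoly w v ≋ δ d w *ₚ (edgePoly (E c w) *ₚ pathPoly w v)
      term w with c ≟F c | w ≟F d | d ≟F w
      ... | no c≢c | _        | _       = contradiction refl c≢c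
      ... | yes _  | yes refl | no d≢w  = contradiction refl d≢w
      ... | yes _  | no w≢d   | yes d≡w = contradiction (sym d≡w) w≢d
      ... | yes _  | no _     | no _    = R.refl
      ... | yes _  | yes refl | yes _   = R.trans
        (R.reflexive (cong (edgePoly (E c w) *ₚ_) (pathPoly-after w v (≤-reflexive (sym (layered e))))))
        (R.sym (R.*-identityˡ (edgePoly (E c w) *ₚ pathPoly w v)))

    walk-onlyEdge : ∀ {v π} → c ≢ v → Walk onlyEdge c π v →
                    ∃₂ λ x ρ → π ≡ x ∷ ρ × E c d ≡ just x × Walk E d ρ v
    walk-onlyEdge c≢v []      = contradiction refl c≢v
    walk-onlyEdge c≢v (e ∷ p) with onlyEdge-at e
    ... | refl = _ , _ , refl , onlyEdge⊑ e , walk-mono onlyEdge⊑ p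

  module Frontier (E : Edges size) (E⊑P : E ⊑ edgeᴾ) (u v : Fin size)
                  (unique : ∀ {π} → Walk E u π v → Unique (variables π))
                  (m>0 : 0 < ∣ Paths.pathVars ℓ E u v ∣) where

    open Walks E E⊑P public

    m : ℕ
    m = ∣ pathVars u v ∣

    Near : Pred (Fin size) _
    Near w = ∣ pathVars u w ∣ ≤ ⌊ m /2⌋

    near? : Decidable Near
    near? w = ∣ pathVars u w ∣ ≤? ⌊ m /2⌋

    near-source : Near u
    near-source = subst (_≤ ⌊ m /2⌋) (sym (∣pathVars-loop∣≡0 u)) z≤n

    far-sink : ¬ Near v
    far-sink m≤m/2 = <-irrefl refl (≤-<-trans m≤m/2 (half< m>0))
      where
      half< : ∀ {k} → 0 < k → ⌊ k /2⌋ < k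
      half< {suc k} _ = ⌊n/2⌋<n k

    IsFrontier : Pred (Fin size × Fin size) _
    IsFrontier (c , d) =
      Near c × ¬ Near d × (∃ λ π → π ∈ paths u c) × (∃ λ x → E c d ≡ just x) × (∃ λ π → π ∈ paths d v)

    isFrontier? : Decidable IsFrontier
    isFrontier? (c , d) =
      near? c ×-dec ¬? (near? d) ×-dec inhabited? (paths u c) ×-dec just? (E c d) ×-dec inhabited? (paths d v)

    pairs : List (Fin size × Fin size)
    pairs = cartesianProduct (allFin size) (allFin size)

    frontier : List (Fin size × Fin size)
    frontier = filter isFrontier? pairs

    crossing-edge : ∀ {c π ρ} → Walk E u π c → Near c → Walk E c ρ v → ∃ λ e → e ∈ frontier
    crossing-edge p near []      = contradiction near far-sink
    crossing-edge {c} p near (_∷_ {w = d} e q) with near? d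
    ... | yes near′ = crossing-edge (p ++ʷ e ∷ []) near′ q
    ... | no  far   = (c , d) , ∈-filter⁺ isFrontier? (∈-cartesianProduct⁺ (∈-allFin c) (∈-allFin d))
                        (near , far , (_ , ∈-paths⁺ p) , (_ , e) , (_ , ∈-paths⁺ q))

    frontier-inhabited : ∃ λ e → e ∈ frontier
    frontier-inhabited with inhabited? (paths u v)
    ... | yes (π , π∈) = crossing-edge [] near-source (∈-paths⁻ π∈)
    ... | no  empty    = contradiction m>0 (≤⇒≯ (subst (m ≤_) (∣⊥∣≡0 n) (p⊆q⇒∣p∣≤∣q∣ {q = ∅} no-vars)))
      where
      no-vars : pathVars u v ⊆ ∅
      no-vars i∈ with ∈-pathVars⁻ u v i∈
      ... | π , p , _ = contradiction (π , ∈-paths⁺ p) empty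

    summand : Fin size × Fin size → Poly
    summand (c , d) = pathPoly u c *ₚ (edgePoly (E c d) *ₚ pathPoly d v)

    pathPoly-frontier : pathPoly u v ≋ sumOver frontier summand
    pathPoly-frontier = begin
      pathPoly u v
        ≈⟨ C.cut near-source far-sink ⟩
      sumOver V (λ c → sumOver V (λ d →
        if ⌊ near? c ⌋ then (if ⌊ near? d ⌋ then [] else summand (c , d)) else []))
        ≈⟨ sum-cong V (λ c → sum-cong V (λ d → term c d)) ⟩
      sumOver V (λ c → sumOver V (λ d → if ⌊ isFrontier? (c , d) ⌋ then summand (c , d) else []))
        ≈⟨ sum-cartesianProductWith _,_ _ V V ⟨
      sumOver pairs (λ e → if ⌊ isFrontier? e ⌋ then summand e else [])
        ≈⟨ sum-filter isFrontier? summand pairs ⟨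
      sumOver frontier summand ∎
      where
      open SetoidReasoning R.setoid
      V = allFin size

      no-return : ∀ {w c} → ¬ Near w → Near c → pathPoly w c ≋ []
      no-return {w} {c} far near with paths w c in eq
      ... | []    = R.refl
      ... | π ∷ _ = contradiction
        (≤-trans (p⊆q⇒∣p∣≤∣q∣ (pathVars-extendʳ {u} (∈-paths⁻ (subst (π ∈_) (sym eq) (here refl))))) near) far

      module C = Cut (λ c d → edgePoly (E c d)) pathPoly rank edgePoly-ranked pathPoly-unfold near? no-return

      pathPoly-empty : ∀ c d → ¬ (∃ λ π → π ∈ paths c d) → pathPoly c d ≡ []
      pathPoly-empty c d empty with paths c d
      ... | []    = refl
      ... | π ∷ _ = contradiction (π , here refl) empty

      term : ∀ c d → (if ⌊ near? c ⌋ then (if ⌊ near? d ⌋ then [] else summand (c , d)) else [])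
                     ≋ (if ⌊ isFrontier? (c , d) ⌋ then summand (c , d) else [])
      term c d with near? c | near? d | inhabited? (paths u c) | just? (E c d) | inhabited? (paths d v)
      ... | no  _ | _     | _     | _     | _     = R.refl
      ... | yes _ | yes _ | _     | _     | _     = R.refl
      ... | yes _ | no  _ | yes _ | yes _ | yes _ = R.refl
      ... | yes _ | no  _ | no  z | _     | _     =
        R.reflexive (cong (_*ₚ (edgePoly (E c d) *ₚ pathPoly d v)) (pathPoly-empty u c z))
      ... | yes _ | no  _ | yes _ | no  z | _     =
        R.trans (R.reflexive (cong (λ y → pathPoly u c *ₚ (y *ₚ pathPoly d v)) (no-edge (E c d) z)))
                (R.zeroʳ (pathPoly u c))
        where
        no-edge : ∀ y → ¬ (∃ λ x → y ≡ just x) → edgePoly y ≡ []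
        no-edge nothing  _ = refl
        no-edge (just x) z = contradiction (x , refl) z
      ... | yes _ | no  _ | yes _ | yes _ | no  z =
        R.trans (R.*-congˡ {pathPoly u c} (R.trans
                  (R.reflexive (cong (edgePoly (E c d) *ₚ_) (pathPoly-empty d v z)))
                  (R.zeroʳ (edgePoly (E c d)))))
                (R.zeroʳ (pathPoly u c))

    module FrontierEdge {c d π₀ x ρ₀} (near : Near c) (far : ¬ Near d)
                        (to : Walk E u π₀ c) (edge : E c d ≡ just x) (from : Walk E d ρ₀ v) where

      open OnlyEdge E E⊑P c d
      module Tail = Walks onlyEdge (E⊑P ∘ onlyEdge⊑)

      c≢v : c ≢ v
      c≢v refl = far-sink near

      unique-++ : ∀ {w π ρ} → Walk E u π w → Walk E w ρ v → Unique (variables π ++ variables ρ)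
      unique-++ {π = π} {ρ} p q = subst Unique (mapMaybe-++ variable? π ρ) (unique (p ++ʷ q))

      head-unique : ∀ {π} → Walk E u π c → Unique (variables π)
      head-unique {π} p = unique-++⁻ˡ (variables π) (unique-++ p (edge ∷ from))

      tail-unique : ∀ {π} → Walk onlyEdge c π v → Unique (variables π)
      tail-unique p = unique-++⁻ʳ (variables π₀) (unique-++ to (walk-mono onlyEdge⊑ p))

      vars-disjoint : ∀ w → Empty (pathVars u w ∩ pathVars w v)
      vars-disjoint w (i , i∈) with x∈p∩q⁻ _ _ i∈
      ... | i∈uw , i∈wv with ∈-pathVars⁻ u w i∈uw | ∈-pathVars⁻ w v i∈wv
      ... | π , p , i∈π | ρ , q , i∈ρ = unique-++⇒disjoint (unique-++ p q) i∈π i∈ρ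

      tail⊆ : Tail.pathVars c v ⊆ pathVars c v
      tail⊆ i∈ with Tail.∈-pathVars⁻ c v i∈
      ... | π , p , i∈π = ∈-pathVars⁺ (walk-mono onlyEdge⊑ p) i∈π

      head-tail-disjoint : Empty (pathVars u c ∩ Tail.pathVars c v)
      head-tail-disjoint (i , i∈) with x∈p∩q⁻ _ _ i∈
      ... | i∈head , i∈tail = vars-disjoint c (i , x∈p∩q⁺ (i∈head , tail⊆ i∈tail))

      head⊆ : pathVars u c ⊆ pathVars u v
      head⊆ = pathVars-extendʳ {u} (edge ∷ from)

      tail⊆whole : Tail.pathVars c v ⊆ pathVars u v
      tail⊆whole = pathVars-extendˡ {w = c} to ∘ tail⊆

      tail⊆label∪rest : Tail.pathVars c v ⊆ ⋃ (map ⁅_⁆ (variables [ x ])) ∪ pathVars d v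
      tail⊆label∪rest i∈ with Tail.∈-pathVars⁻ c v i∈
      ... | π , p , i∈π with walk-onlyEdge c≢v p
      ... | y , ρ , refl , e , q with just-injective (trans (sym e) edge)
      ... | refl with ∈-++⁻ (variables [ x ]) (subst (_ ∈_) (mapMaybe-++ variable? [ x ] ρ) i∈π)
      ... | inj₁ i∈x = x∈p∪q⁺ (inj₁ (∈⋃⁺ (Any-map⁺ (Any.map (λ where refl → x∈⁅x⁆ _) i∈x))))
      ... | inj₂ i∈ρ = x∈p∪q⁺ (inj₂ (∈-pathVars⁺ q i∈ρ))

      ∣label∣≤1 : ∀ y → ∣ ⋃ (map ⁅_⁆ (variables [ y ])) ∣ ≤ 1
      ∣label∣≤1 (const _) = subst (_≤ 1) (sym (∣⊥∣≡0 n)) z≤n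
      ∣label∣≤1 (var i)   = ≤-trans (∣p∪q∣≤∣p∣+∣q∣ ⁅ i ⁆ ∅) (≤-reflexive (cong₂ _+_ (∣⁅x⁆∣≡1 i) (∣⊥∣≡0 n)))

      ∣rest∣<⌈m/2⌉ : suc ∣ pathVars d v ∣ ≤ ⌈ m /2⌉
      ∣rest∣<⌈m/2⌉ = +-cancelˡ-≤ ⌊ m /2⌋ _ _ (begin
        ⌊ m /2⌋ + suc ∣ pathVars d v ∣        ≡⟨ +-suc ⌊ m /2⌋ _ ⟩
        suc ⌊ m /2⌋ + ∣ pathVars d v ∣        ≤⟨ +-monoˡ-≤ _ (≰⇒> far) ⟩
        ∣ pathVars u d ∣ + ∣ pathVars d v ∣   ≤⟨ disjoint⇒∣p∣+∣q∣≤∣p∪q∣ (pathVars u d) _ (vars-disjoint d) ⟩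
        ∣ pathVars u d ∪ pathVars d v ∣       ≤⟨ p⊆q⇒∣p∣≤∣q∣ {q = pathVars u v} parts⊆whole ⟩
        m                                     ≡⟨ ⌊n/2⌋+⌈n/2⌉≡n m ⟨
        ⌊ m /2⌋ + ⌈ m /2⌉                     ∎)
        where
        open ≤-Reasoning
        parts⊆whole : pathVars u d ∪ pathVars d v ⊆ pathVars u v
        parts⊆whole i∈ with x∈p∪q⁻ (pathVars u d) _ i∈
        ... | inj₁ i∈ud = pathVars-extendʳ {u} from i∈ud
        ... | inj₂ i∈dv = pathVars-extendˡ {w = d} (to ++ʷ edge ∷ []) i∈dv

      ∣tail∣≤⌈m/2⌉ : ∣ Tail.pathVars c v ∣ ≤ ⌈ m /2⌉
      ∣tail∣≤⌈m/2⌉ = begin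
        ∣ Tail.pathVars c v ∣                                       ≤⟨ p⊆q⇒∣p∣≤∣q∣ tail⊆label∪rest ⟩
        ∣ ⋃ (map ⁅_⁆ (variables [ x ])) ∪ pathVars d v ∣           ≤⟨ ∣p∪q∣≤∣p∣+∣q∣ (⋃ (map ⁅_⁆ (variables [ x ]))) _ ⟩
        ∣ ⋃ (map ⁅_⁆ (variables [ x ])) ∣ + ∣ pathVars d v ∣       ≤⟨ +-monoˡ-≤ _ (∣label∣≤1 x) ⟩
        suc ∣ pathVars d v ∣                                       ≤⟨ ∣rest∣<⌈m/2⌉ ⟩
        ⌈ m /2⌉                                                    ∎
        where open ≤-Reasoning

      head*tail : pathPoly u c *ₚ Tail.pathPoly c v ≋ pathPoly u c *ₚ (edgePoly (E c d) *ₚ pathPoly d v)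
      head*tail = R.*-congˡ {pathPoly u c} (pathPoly-onlyEdge c≢v edge)

-- Formulas

length-cartesianProduct : ∀ {a b} {A : Set a} {B : Set b} (xs : List A) (ys : List B) →
                          length (cartesianProduct xs ys) ≡ length xs * length ys
length-cartesianProduct []       ys = refl
length-cartesianProduct (x ∷ xs) ys =
  trans (length-++ (map (x ,_) ys)) (cong₂ _+_ (length-map (x ,_) ys) (length-cartesianProduct xs ys))

sum-tabulate-≤ : ∀ {k b} (f : Fin k → ℕ) → (∀ i → f i ≤ b) → sum (tabulate f) ≤ k * b
sum-tabulate-≤ {zero}    f f≤b = z≤n
sum-tabulate-≤ {suc k} f f≤b = +-mono-≤ (f≤b zero) (sum-tabulate-≤ (f ∘ suc) (f≤b ∘ suc))

max-tabulate-≤ : ∀ {k b} (f : Fin k → ℕ) → (∀ i → f i ≤ b) → foldr _⊔_ 0 (tabulate f) ≤ b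
max-tabulate-≤ {zero}    f f≤b = z≤n
max-tabulate-≤ {suc k} f f≤b = ⊔-lub (f≤b zero) (max-tabulate-≤ (f ∘ suc) (f≤b ∘ suc))

⋃-tabulate-⊆ : ∀ {n k} {q : Subset n} (f : Fin k → Subset n) → (∀ i → f i ⊆ q) → ⋃ (tabulate f) ⊆ q
⋃-tabulate-⊆ {k = zero}    f f⊆q i∈ = contradiction i∈ ∉⊥
⋃-tabulate-⊆ {k = suc k} f f⊆q i∈ with x∈p∪q⁻ (f zero) _ i∈
... | inj₁ i∈f0 = f⊆q zero i∈f0
... | inj₂ i∈fs = ⋃-tabulate-⊆ (f ∘ suc) (f⊆q ∘ suc) i∈fs

module _ {S : ℕ} {s : ℕ} (S≥2 : 2 ≤ S) (s≥1 : 1 ≤ s) where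

  level-size : ∀ {k} → k ≤ S * S → suc (k * suc (s + s)) ≤ S * (S * (S * (S * s)))
  level-size {k} k≤S² = begin
    suc (k * suc (s + s))           ≤⟨ +-mono-≤ (*-mono-≤ 1≤q s≥1) (*-mono-≤ k≤S² (+-monoˡ-≤ (s + s) s≥1)) ⟩
    q * s + q * (s + (s + s))       ≡⟨ four q s ⟩
    q * (4 * s)                     ≤⟨ *-monoʳ-≤ q (*-monoˡ-≤ s (*-mono-≤ S≥2 S≥2)) ⟩
    q * (q * s)                     ≡⟨ reassoc S s ⟩
    S * (S * (S * (S * s)))         ∎
    where
    open ≤-Reasoning
    q = S * S

    1≤q : 1 ≤ q
    1≤q = ≤-trans (s≤s z≤n) (*-mono-≤ S≥2 S≥2)

    four : ∀ q s → q * s + q * (s + (s + s)) ≡ q * (4 * s)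
    four = solve-∀

    reassoc : ∀ S s → (S * S) * ((S * S) * s) ≡ S * (S * (S * (S * s)))
    reassoc = solve-∀

distinct⇒size≥2 : ∀ {S} {u v : Fin S} → u ≢ v → 2 ≤ S
distinct⇒size≥2 {suc zero}      {zero} {zero} u≢v = contradiction refl u≢v
distinct⇒size≥2 {suc (suc S)}                u≢v = s≤s (s≤s z≤n)

module Building {a ℓ₁ ℓ₂} (𝔽 : HeytingField a ℓ₁ ℓ₂) (n : ℕ) (P : Multilinear.ABP 𝔽 n) where

  open Multilinear 𝔽 n
  open PolySemiring 𝔽 n
  open ABP P using (size; ℓ; layer; source; sink) renaming (edge to edgeᴾ)
  open ListSum polySemiring
  open ProgramPaths 𝔽 n P
  open Splitting 𝔽 n P
  private module R = Semiring polySemiring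
  private module F = HeytingField 𝔽

  exponents≤1⇒multilinear : ∀ p → (∀ {t} → t ∈ p → ∀ i → Vec.lookup (proj₂ t) i ≤ 1) → IsMultilinear p
  exponents≤1⇒multilinear []            _   α i αᵢ≥2 = F.refl
  exponents≤1⇒multilinear ((c , β) ∷ p) ≤1 α i αᵢ≥2 with ≡-dec _≟ℕ_ β α
  ... | yes refl = contradiction (≤1 (here refl) i) (<⇒≱ αᵢ≥2)
  ... | no  _    = F.trans (F.+-identityˡ _) (exponents≤1⇒multilinear p (≤1 ∘ there) α i αᵢ≥2)

  ∈-*ₚ⁻ : ∀ p q {t} → t ∈ p *ₚ q → ∀ i →
          ∃₂ λ s r → s ∈ p × r ∈ q × Vec.lookup (proj₂ t) i ≡ Vec.lookup (proj₂ s) i + Vec.lookup (proj₂ r) i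
  ∈-*ₚ⁻ p q t∈ i with ∈-cartesianProductWith⁻ _ p q t∈
  ... | s , r , s∈ , r∈ , refl = s , r , s∈ , r∈ , lookup-zipWith _+_ i (proj₂ s) (proj₂ r)

  var-exponent-same : ∀ i → Vec.lookup (Vec.replicate n 0 Vec.[ i ]≔ 1) i ≡ 1
  var-exponent-same i = lookup∘update i (Vec.replicate n 0) 1

  var-exponent-other : ∀ {i j} → i ≢ j → Vec.lookup (Vec.replicate n 0 Vec.[ j ]≔ 1) i ≡ 0
  var-exponent-other {i} i≢j = trans (lookup∘update′ i≢j (Vec.replicate n 0) 1) (lookup-replicate i 0)

  absent⇒exponent≡0 : ∀ π {t i} → ¬ i ∈ variables π → t ∈ walkPoly π → Vec.lookup (proj₂ t) i ≡ 0
  absent⇒exponent≡0 [] {i = i} i∉ (here refl) = lookup-replicate i 0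
  absent⇒exponent≡0 (const c ∷ π) {i = i} i∉ t∈ with ∈-*ₚ⁻ (constₚ c) (walkPoly π) t∈ i
  ... | _ , r , here refl , r∈ , eq = trans eq (cong₂ _+_ (lookup-replicate i 0) (absent⇒exponent≡0 π i∉ r∈))
  absent⇒exponent≡0 (var j ∷ π) {i = i} i∉ t∈ with ∈-*ₚ⁻ (varₚ j) (walkPoly π) t∈ i
  ... | _ , r , here refl , r∈ , eq = trans eq (cong₂ _+_
    (var-exponent-other (i∉ ∘ here)) (absent⇒exponent≡0 π (i∉ ∘ there) r∈))

  unique⇒exponent≤1 : ∀ π {t} → Unique (variables π) → t ∈ walkPoly π → ∀ i → Vec.lookup (proj₂ t) i ≤ 1
  unique⇒exponent≤1 [] _ (here refl) i = subst (_≤ 1) (sym (lookup-replicate i 0)) z≤n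
  unique⇒exponent≤1 (const c ∷ π) π! t∈ i with ∈-*ₚ⁻ (constₚ c) (walkPoly π) t∈ i
  ... | _ , r , here refl , r∈ , eq =
    subst (_≤ 1) (sym (trans eq (cong (_+ Vec.lookup (proj₂ r) i) (lookup-replicate i 0)))) (unique⇒exponent≤1 π π! r∈ i)
  unique⇒exponent≤1 (var j ∷ π) (j∉π ∷ π!) t∈ i with ∈-*ₚ⁻ (varₚ j) (walkPoly π) t∈ i | i ≟F j
  ... | _ , r , here refl , r∈ , eq | yes refl = ≤-reflexive (trans eq (cong₂ _+_ (var-exponent-same i)
    (absent⇒exponent≡0 π (λ i∈π → All.lookup j∉π i∈π refl) r∈)))
  ... | _ , r , here refl , r∈ , eq | no i≢j = subst (_≤ 1)
    (sym (trans eq (cong (_+ Vec.lookup (proj₂ r) i) (var-exponent-other i≢j))))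
    (unique⇒exponent≤1 π π! r∈ i)

  IsSmallLeaf : Leaf P → Set ℓ₁
  IsSmallLeaf w = IsMultilinear (Leaf.poly w) × ∣ Leaf.vars w ∣ * ∣ Leaf.vars w ∣ ≤ n

  record Realization (p : Poly) (X : Subset n) (s k c : ℕ) : Set (a ⊔ˡ ℓ₁) where
    field
      formula              : Formula P
      syntacticMultilinear : IsSyntacticMultilinearFormula formula
      computes             : formulaPoly formula ≋ p
      vars⊆                : formulaVars formula ⊆ X
      size≤                : formulaSize formula ≤ s
      depth≤               : depth formula ≤ k
      smallLeaves          : AllLeaves IsSmallLeaf formula
      leafCount≤           : (τ : ParseTree formula) → leafCount τ ≤ c

  open Realization

  weaken : ∀ {p X s s′ k k′ c c′} → s ≤ s′ → k ≤ k′ → c ≤ c′ → Realization p X s k c → Realization p X s′ k′ c′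
  weaken s≤ k≤ c≤ ρ = record
    { formula              = formula ρ
    ; syntacticMultilinear = syntacticMultilinear ρ
    ; computes             = computes ρ
    ; vars⊆                = vars⊆ ρ
    ; size≤                = ≤-trans (size≤ ρ) s≤
    ; depth≤               = ≤-trans (depth≤ ρ) k≤
    ; smallLeaves          = smallLeaves ρ
    ; leafCount≤           = λ τ → ≤-trans (leafCount≤ ρ τ) c≤
    }

  product : ∀ {p q X Y Z s k c} → Empty (X ∩ Y) → X ⊆ Z → Y ⊆ Z →
            Realization p X s k c → Realization q Y s k c →
            Realization (p *ₚ q) Z (suc (s + s)) (suc k) (c + c)
  product {Z = Z} {s} {k} {c} X∥Y X⊆Z Y⊆Z ρ σ = record
    { formula              = formula ρ ⊗ formula σ
    ; syntacticMultilinear = disjoint , syntacticMultilinear ρ , syntacticMultilinear σ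
    ; computes             = R.*-cong (computes ρ) (computes σ)
    ; vars⊆                = included
    ; size≤                = s≤s (+-mono-≤ (size≤ ρ) (size≤ σ))
    ; depth≤               = s≤s (⊔-lub (depth≤ ρ) (depth≤ σ))
    ; smallLeaves          = smallLeaves ρ , smallLeaves σ
    ; leafCount≤           = λ where (τ ⊗ υ) → +-mono-≤ (leafCount≤ ρ τ) (leafCount≤ σ υ)
    }
    where
    disjoint : Empty (formulaVars (formula ρ) ∩ formulaVars (formula σ))
    disjoint (i , i∈) with x∈p∩q⁻ (formulaVars (formula ρ)) _ i∈
    ... | i∈ρ , i∈σ = X∥Y (i , x∈p∩q⁺ (vars⊆ ρ i∈ρ , vars⊆ σ i∈σ))

    included : formulaVars (formula ρ) ∪ formulaVars (formula σ) ⊆ Z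
    included i∈ with x∈p∪q⁻ (formulaVars (formula ρ)) _ i∈
    ... | inj₁ i∈ρ = X⊆Z (vars⊆ ρ i∈ρ)
    ... | inj₂ i∈σ = Y⊆Z (vars⊆ σ i∈σ)

  ∑-tabulate-cong : ∀ {i} {I : Set i} (xs : List I) (f : I → Poly) (g : Fin (length xs) → Poly) →
                    (∀ j → g j ≋ f (lookup xs j)) → ∑ (tabulate g) ≋ sumOver xs f
  ∑-tabulate-cong []       f g g≋f = R.refl
  ∑-tabulate-cong (x ∷ xs) f g g≋f = R.+-cong (g≋f zero) (∑-tabulate-cong xs f (g ∘ suc) (g≋f ∘ suc))

  summation : ∀ {i} {I : Set i} {X s k c} (xs : List I) (f : I → Poly) → (∃ λ x → x ∈ xs) →
              (∀ {x} → x ∈ xs → Realization (f x) X s k c) →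
              Realization (sumOver xs f) X (suc (length xs * s)) (suc k) c
  summation (x ∷ xs) f _ ρ = record
    { formula              = plus (formula ∘ ρᵢ)
    ; syntacticMultilinear = syntacticMultilinear ∘ ρᵢ
    ; computes             = ∑-tabulate-cong (x ∷ xs) f (λ i → formulaPoly (formula (ρᵢ i))) (computes ∘ ρᵢ)
    ; vars⊆                = ⋃-tabulate-⊆ (λ i → formulaVars (formula (ρᵢ i))) (λ i → vars⊆ (ρᵢ i))
    ; size≤                = s≤s (sum-tabulate-≤ (λ i → formulaSize (formula (ρᵢ i))) (size≤ ∘ ρᵢ))
    ; depth≤               = s≤s (max-tabulate-≤ (λ i → depth (formula (ρᵢ i))) (depth≤ ∘ ρᵢ))
    ; smallLeaves          = smallLeaves ∘ ρᵢ
    ; leafCount≤           = λ where (plus i τ) → leafCount≤ (ρᵢ i) τ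
    }
    where
    ρᵢ : ∀ i → Realization (f (lookup (x ∷ xs) i)) _ _ _ _
    ρᵢ i = ρ (∈-lookup i)

  recompute : ∀ {p q X s k c} → p ≋ q → Realization p X s k c → Realization q X s k c
  recompute p≋q ρ = record
    { formula              = formula ρ
    ; syntacticMultilinear = syntacticMultilinear ρ
    ; computes             = R.trans (computes ρ) p≋q
    ; vars⊆                = vars⊆ ρ
    ; size≤                = size≤ ρ
    ; depth≤               = depth≤ ρ
    ; smallLeaves          = smallLeaves ρ
    ; leafCount≤           = leafCount≤ ρ
    }

  module _ (E : Edges size) (E⊑P : E ⊑ edgeᴾ) (u v : Fin size) where

    open Walks E E⊑P

    pathPoly-multilinear : (∀ {π} → Walk E u π v → Unique (variables π)) → IsMultilinear (pathPoly u v)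
    pathPoly-multilinear unique = exponents≤1⇒multilinear (pathPoly u v) exponent≤1
      where
      exponent≤1 : ∀ {t} → t ∈ pathPoly u v → ∀ i → Vec.lookup (proj₂ t) i ≤ 1
      exponent≤1 t∈ with find (∈-concatMap⁻ walkPoly {xs = paths u v} t∈)
      ... | π , π∈ , t∈π = unique⇒exponent≤1 π (unique (∈-paths⁻ π∈)) t∈π

    singleLeaf : (∀ {π} → Walk E u π v → Unique (variables π)) → ∣ pathVars u v ∣ * ∣ pathVars u v ∣ ≤ n →
                 Realization (pathPoly u v) (pathVars u v) 1 0 1
    singleLeaf unique small = record
      { formula = leaf (record
        { program = record
          { nodes        = full
          ; edge         = E
          ; source       = u
          ; sink         = v
          ; source∈nodes = ∈⊤
          ; sink∈nodes   = ∈⊤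
          ; edge⊆        = λ e → E⊑P e , ∈⊤ , ∈⊤
          }
        ; u       = u
        ; v       = v
        ; u∈nodes = ∈⊤
        ; v∈nodes = ∈⊤
        })
      ; syntacticMultilinear = tt
      ; computes             = R.refl
      ; vars⊆                = λ i∈ → i∈
      ; size≤                = ≤-refl
      ; depth≤               = z≤n
      ; smallLeaves          = pathPoly-multilinear unique , small
      ; leafCount≤           = λ where leaf → ≤-refl
      }

  size≥1 : 1 ≤ size
  size≥1 = ≤-trans (s≤s z≤n) (toℕ<n source)

  power≥1 : ∀ k → 1 ≤ size ^ k
  power≥1 k = m^n>0 size k
    where instance size≢0 = >-nonZero size≥1

  module _ {r : ℕ} (r≥1 : 1 ≤ r) (r²≤n : r * r ≤ n) where

    refine : ∀ d (E : Edges size) (E⊑P : E ⊑ edgeᴾ) (u v : Fin size) →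
             (∀ {π} → Walk E u π v → Unique (variables π)) →
             ∣ Paths.pathVars ℓ E u v ∣ ≤ r * 2 ^ d →
             Realization (Paths.pathPoly ℓ E u v) (Paths.pathVars ℓ E u v) (size ^ (4 * d)) (2 * d) (2 ^ d)
    refine d E E⊑P u v unique m≤ with ∣ Paths.pathVars ℓ E u v ∣ ≤? r
    ... | yes m≤r = weaken (power≥1 (4 * d)) z≤n (m^n>0 2 d)
                      (singleLeaf E E⊑P u v unique (≤-trans (*-mono-≤ m≤r m≤r) r²≤n))
    refine zero    E E⊑P u v unique m≤ | no m≰r = contradiction (subst (_ ≤_) (*-identityʳ r) m≤) m≰r
    refine (suc d) E E⊑P u v unique m≤ | no m≰r =
      weaken size-step (≤-reflexive (sym (*-suc 2 d))) (+-monoʳ-≤ (2 ^ d) (≤-reflexive (sym (+-identityʳ _))))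
        (recompute (R.sym pathPoly-frontier) (summation frontier summand frontier-inhabited part))
      where
      open Frontier E E⊑P u v unique (≤-trans r≥1 (<⇒≤ (≰⇒> m≰r)))

      doubled : m ≤ r * 2 ^ d + r * 2 ^ d
      doubled = ≤-trans m≤ (≤-reflexive (double r (2 ^ d)))
        where
        double : ∀ r x → r * (2 * x) ≡ r * x + r * x
        double = solve-∀

      part : ∀ {e} → e ∈ frontier → Realization (summand e) (pathVars u v)
                      (suc (size ^ (4 * d) + size ^ (4 * d))) (suc (2 * d)) (2 ^ d + 2 ^ d)
      part {c , e} e∈ with ∈-filter⁻ isFrontier? {xs = pairs} e∈
      ... | _ , near , far , (_ , to) , (_ , edge) , (_ , from) =
        recompute head*tail (product head-tail-disjoint head⊆ tail⊆whole
          (refine d E E⊑P u c head-unique (≤-trans near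
            (≤-trans (⌊n/2⌋-mono doubled) (≤-reflexive (sym (n≡⌊n+n/2⌋ _))))))
          (refine d onlyEdge (E⊑P ∘ onlyEdge⊑) c v tail-unique (≤-trans ∣tail∣≤⌈m/2⌉
            (≤-trans (⌈n/2⌉-mono doubled) (≤-reflexive (sym (n≡⌈n+n/2⌉ _)))))))
        where
        open FrontierEdge near far (∈-paths⁻ to) edge (∈-paths⁻ from)
        open OnlyEdge E E⊑P c e

      size-step : suc (length frontier * suc (size ^ (4 * d) + size ^ (4 * d))) ≤ size ^ (4 * suc d)
      size-step = ≤-trans (level-size (distinct⇒size≥2 u≢v) (power≥1 (4 * d)) frontier-length)
                          (≤-reflexive (cong (size ^_) (sym (*-suc 4 d))))
        where
        u≢v : u ≢ v
        u≢v refl = far-sink near-source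

        frontier-length : length frontier ≤ size * size
        frontier-length = ≤-trans (length-filter isFrontier? pairs) (≤-reflexive
          (trans (length-cartesianProduct (allFin size) (allFin size)) (cong₂ _*_ ∣V∣≡size ∣V∣≡size)))
          where
          ∣V∣≡size : length (allFin size) ≡ size
          ∣V∣≡size = length-tabulate id

floor-sqrt : ∀ n → ∃ λ r → r * r ≤ n × n ≤ r * (2 + r)
floor-sqrt zero    = 0 , z≤n , z≤n
floor-sqrt (suc n) with floor-sqrt n
... | r , r²≤n , n≤r²+2r with suc n ≤? r * (2 + r)
... | yes 1+n≤ = r , m≤n⇒m≤1+n r²≤n , 1+n≤
... | no  1+n≰ = suc r , ≤-trans (≤-reflexive (square r)) (≰⇒> 1+n≰)
               , ≤-trans (s≤s n≤r²+2r) (≤-trans (m≤m+n _ (2 + (r + r))) (≤-reflexive (next r)))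
  where
  square : ∀ r → suc r * suc r ≡ suc (r * (2 + r))
  square = solve-∀
  next : ∀ r → suc (r * (2 + r)) + (2 + (r + r)) ≡ suc r * (3 + r)
  next = solve-∀

power-between : ∀ r → ∃ λ d → 2 ^ d ≤ suc r × 2 + r ≤ 2 ^ suc d
power-between zero    = 0 , ≤-refl , ≤-refl
power-between (suc r) with power-between r
... | d , 2^d≤ , ≤2^d with 3 + r ≤? 2 ^ suc d
... | yes 3+r≤ = d , m≤n⇒m≤1+n 2^d≤ , 3+r≤
... | no  3+r≰ = suc d , s≤s⁻¹ (≰⇒> 3+r≰)
               , ≤-trans (+-mono-≤ (m^n>0 2 (suc d)) ≤2^d) (≤-reflexive (cong (2 ^ suc d +_) (sym (+-identityʳ _))))

lemma4 : ∀ {a ℓ₁ ℓ₂} → ∃₂ λ (C D : ℕ) →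
    ∀ (𝔽 : HeytingField a ℓ₁ ℓ₂) (n : ℕ) → 1 ≤ n →
    let open Multilinear 𝔽 n in
    ∀ (P : ABP) (f : Poly) →
    ABP.IsSyntacticMultilinear P → ABP.poly P ≈ₚ f → IsMultilinear f →
    ∃ λ (Φ : Formula P) →
    IsSyntacticMultilinearFormula Φ
    × formulaPoly Φ ≈ₚ f
    × formulaSize Φ ≤ ABP.size P ^ (C * ⌊log₂ n ⌋)
    × depth Φ ≤ D * ⌊log₂ n ⌋
    × AllLeaves (λ w → IsMultilinear (Leaf.poly w) × ∣ Leaf.vars w ∣ * ∣ Leaf.vars w ∣ ≤ n) Φ
    × (∀ (τ : ParseTree Φ) → leafCount τ * leafCount τ ≤ 9 * n)
lemma4 {a} {ℓ₁} {ℓ₂} = 8 , 4 , theorem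
  where
  theorem : ∀ (𝔽 : HeytingField a ℓ₁ ℓ₂) (n : ℕ) → 1 ≤ n →
    let open Multilinear 𝔽 n in
    ∀ (P : ABP) (f : Poly) →
    ABP.IsSyntacticMultilinear P → ABP.poly P ≈ₚ f → IsMultilinear f →
    ∃ λ (Φ : Formula P) →
    IsSyntacticMultilinearFormula Φ
    × formulaPoly Φ ≈ₚ f
    × formulaSize Φ ≤ ABP.size P ^ (8 * ⌊log₂ n ⌋)
    × depth Φ ≤ 4 * ⌊log₂ n ⌋
    × AllLeaves (λ w → IsMultilinear (Leaf.poly w) × ∣ Leaf.vars w ∣ * ∣ Leaf.vars w ∣ ≤ n) Φ
    × (∀ (τ : ParseTree Φ) → leafCount τ * leafCount τ ≤ 9 * n)
  theorem 𝔽 n n≥1 P f P-multilinear P≈f _ = conclude (realization n≥1)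
    where
    open Multilinear 𝔽 n
    open ABP P using (size; ℓ; source; sink; poly; pathVars) renaming (edge to edgeᴾ)
    open PolySemiring 𝔽 n using (≋⇒≈ₚ)
    open ProgramPaths 𝔽 n P
    open Building 𝔽 n P

    L = ⌊log₂ n ⌋

    conclude : (∃ λ c → c * c ≤ 9 * n × Realization poly (pathVars source sink) (size ^ (8 * L)) (4 * L) c) → _
    conclude (c , c²≤9n , ρ) =
      formula , syntacticMultilinear
      , (λ α → HeytingField.trans 𝔽 (≋⇒≈ₚ computes α) (P≈f α))
      , size≤ , depth≤ , smallLeaves
      , λ τ → ≤-trans (*-mono-≤ (leafCount≤ τ) (leafCount≤ τ)) c²≤9n
      where open Realization ρ

    unique : ∀ {π} → Walk edgeᴾ source π sink → Unique (variables π)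
    unique p = All.lookup P-multilinear (Walks.∈-paths⁺ edgeᴾ id p)

    realization : 1 ≤ n → ∃ λ c → c * c ≤ 9 * n × Realization poly (pathVars source sink) (size ^ (8 * L)) (4 * L) c
    realization n≥1 with 2 ≤? n
    ... | no  n≱2 = 1 , *-mono-≤ {1} {9} (s≤s z≤n) n≥1 ,
      weaken (power≥1 (8 * L)) z≤n ≤-refl (singleLeaf edgeᴾ id source sink unique
        (subst (∣X∣ * ∣X∣ ≤_) (*-identityʳ n) (*-mono-≤ (∣p∣≤n X) (≤-trans (∣p∣≤n X) (s≤s⁻¹ (≰⇒> n≱2))))))
      where
      X = pathVars source sink
      ∣X∣ = ∣ X ∣
    ... | yes n≥2 with floor-sqrt n
    ... | r , r²≤n , n≤r²+2r with power-between r
    ... | d , 2^d≤1+r , 2+r≤2^1+d =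
      2 ^ suc d , leaves≤ , weaken size-bound depth-bound ≤-refl
        (refine r≥1 r²≤n (suc d) edgeᴾ id source sink unique
          (≤-trans (∣p∣≤n (pathVars source sink)) (≤-trans n≤r²+2r (*-monoʳ-≤ r 2+r≤2^1+d))))
      where
      r≥1 : 1 ≤ r
      r≥1 = positive n≤r²+2r
        where
        positive : ∀ {r} → n ≤ r * (2 + r) → 1 ≤ r
        positive {zero}    n≤0 = contradiction (≤-trans n≥2 n≤0) λ ()
        positive {suc r} _   = s≤s z≤n

      leaves≤ : 2 ^ suc d * 2 ^ suc d ≤ 9 * n
      leaves≤ = ≤-trans (*-mono-≤ 2^1+d≤ 2^1+d≤) (square≤ r≥1 r²≤n)
        where
        2^1+d≤ : 2 ^ suc d ≤ 2 * suc r
        2^1+d≤ = *-monoʳ-≤ 2 2^d≤1+r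

        square≤ : ∀ {r} → 1 ≤ r → r * r ≤ n → (2 * suc r) * (2 * suc r) ≤ 9 * n
        square≤ {suc zero}      _ _ = ≤-trans (m≤m+n 16 2) (*-monoʳ-≤ 9 n≥2)
        square≤ {suc (suc r)} _ r²≤n = ≤-trans (*-mono-≤ triple triple)
          (≤-trans (≤-reflexive (nine (2 + r))) (*-monoʳ-≤ 9 r²≤n))
          where
          triple : 2 * (3 + r) ≤ 3 * (2 + r)
          triple = ≤-trans (m≤m+n _ r) (≤-reflexive (solve r))
            where
            solve : ∀ r → 2 * (3 + r) + r ≡ 3 * (2 + r)
            solve = solve-∀

          nine : ∀ k → (3 * k) * (3 * k) ≡ 9 * (k * k)
          nine = solve-∀

      1+r≤n : suc r ≤ n
      1+r≤n = go r≥1 r²≤n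
        where
        go : ∀ {r} → 1 ≤ r → r * r ≤ n → suc r ≤ n
        go {suc zero}      _ _    = n≥2
        go {suc (suc r)} _ r²≤n = ≤-trans (≤-trans (m≤m+n (3 + r) _) (≤-reflexive (expand r))) r²≤n
          where
          expand : ∀ r → 3 + r + (1 + 3 * r + r * r) ≡ (2 + r) * (2 + r)
          expand = solve-∀

      d≤L : d ≤ L
      d≤L = ≤-trans (≤-reflexive (sym (⌊log₂[2^n]⌋≡n d))) (⌊log₂⌋-mono-≤ (≤-trans 2^d≤1+r 1+r≤n))

      1+d≤2L : suc d ≤ 2 * L
      1+d≤2L = ≤-trans (+-mono-≤ (⌊log₂⌋-mono-≤ n≥2) d≤L) (≤-reflexive (cong (L +_) (sym (+-identityʳ L))))

      size-bound : size ^ (4 * suc d) ≤ size ^ (8 * L)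
      size-bound = ^-monoʳ-≤ size (≤-trans (*-monoʳ-≤ 4 1+d≤2L) (≤-reflexive (sym (*-assoc 4 2 L))))
        where instance size≢0 = >-nonZero size≥1

      depth-bound : 2 * suc d ≤ 4 * L
      depth-bound = ≤-trans (*-monoʳ-≤ 2 1+d≤2L) (≤-reflexive (sym (*-assoc 2 2 L)))
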